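{- For every $\alpha\in(0,1)$ there exists a constant $\lambda=\lambda(\alpha)>0$ such that the following holds. Let $G_\alpha$ be any graph on the vertex set $[n]$ with minimum degree $\delta(G_\alpha)\ge \alpha n$, and let $p=p(n)$ satisfy $\frac{1}{n^2}\ll p \ll \frac1n$. Then with high probability the randomly perturbed graph $H=G_\alpha\cup G(n,p)$ has the property that for every coloring $\chi:E(H)\to\{+1,-1\}$ there is a spanning tree $T$ of $H$ with \[ \Bigl|\sum_{e\in E(T)}\chi(e)\Bigr| \ge \lambda p n^2 . \]
   Context: $G(n,p)$ is the binomial random graph on the same vertex set $[n]$, each pair joined independently with probability $p$, and $H=G_\alpha\cup G(n,p)$ is the graph on $[n]$ whose edge set is the union of the two edge sets. $\frac{1}{n^2}\ll p\ll\frac1n$ means $pn^2\to\infty$ and $pn\to 0$ as $n\to\infty$. "With high probability" means with probability tending to $1$ as $n\to\infty$.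
   Formalization: The minimum-degree parameter α and the edge probabilities p(n) are taken to be rational numbers instead of real numbers; the constant λ obtained is rational as well. -}

module Defs where

open import Data.Bool using (Bool; true; false; if_then_else_; _∨_)
open import Data.Nat using (ℕ; zero; suc; _∸_; _<ᵇ_; _≥_)
import Data.Nat as ℕ
open import Data.Integer using (ℤ; +_; -[1+_])
import Data.Integer as ℤ
open import Data.Rational using (ℚ; _/_; 0ℚ; 1ℚ; _-_; _*_; _+_; _≤_; _<_; ∣_∣)
open import Data.Fin using (Fin; toℕ)
open import Data.List using (List; []; _∷_; length; filterᵇ; cartesianProduct; allFin; map; foldr; lookup)
open import Data.List.Relation.Unary.All using (All)
open import Data.List.Relation.Unary.Unique.Propositional using (Unique)
open import Data.Vec using (Vec)
import Data.Vec as Vec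
open import Data.Product using (Σ; ∃; _×_; _,_)
open import Data.Sum using (_⊎_)
open import Relation.Binary.PropositionalEquality using (_≡_)

ℕ→ℚ : ℕ → ℚ
ℕ→ℚ n = + n / 1

ℤ→ℚ : ℤ → ℚ
ℤ→ℚ z = z / 1

record Graph (n : ℕ) : Set where
  field
    adj     : Fin n → Fin n → Bool
    adj-sym : ∀ u v → adj u v ≡ adj v u
    irrefl  : ∀ v → adj v v ≡ false
open Graph public

degree : ∀ {n} → Graph n → Fin n → ℕ
degree {n} G v = foldr ℕ._+_ 0 (map (λ u → if adj G v u then 1 else 0) (allFin n))

MinDegAtLeast : ∀ {n} → Graph n → ℚ → Set
MinDegAtLeast {n} G α = ∀ v → α * ℕ→ℚ n ≤ ℕ→ℚ (degree G v)

-- The unordered pairs {i,j} (i<j) of [n], i.e. the edge slots of K_n.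
pairs : (n : ℕ) → List (Fin n × Fin n)
pairs n = filterᵇ (λ { (i , j) → toℕ i <ᵇ toℕ j }) (cartesianProduct (allFin n) (allFin n))

M : ℕ → ℕ
M n = length (pairs n)

-- An outcome of G(n,p): for each slot, whether the edge is present.
Outcome : ℕ → Set
Outcome n = Vec Bool (M n)

weight : ∀ {m} → ℚ → Vec Bool m → ℚ
weight p Vec.[] = 1ℚ
weight p (b Vec.∷ bs) = (if b then p else (1ℚ - p)) * weight p bs

-- P[A] ≥ r : there are distinct outcomes all in A of total probability ≥ r.
ProbAtLeast : (n : ℕ) → ℚ → (Outcome n → Set) → ℚ → Set
ProbAtLeast n p A r =
  Σ (List (Outcome n)) λ L → Unique L × All A L × (r ≤ foldr _+_ 0ℚ (map (weight p) L))

HEdge : ∀ {n} → Graph n → Outcome n → Fin (M n) → Bool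
HEdge {n} G ω k with lookup (pairs n) k
... | (i , j) = adj G i j ∨ Vec.lookup ω k

EdgeSet : ℕ → Set
EdgeSet n = Fin (M n) → Bool

TAdj : ∀ {n} → EdgeSet n → Fin n → Fin n → Set
TAdj {n} T u v = ∃ λ k → T k ≡ true × (lookup (pairs n) k ≡ (u , v) ⊎ lookup (pairs n) k ≡ (v , u))

data Reach {n} (T : EdgeSet n) (u : Fin n) : Fin n → Set where
  here : Reach T u u
  step : ∀ {w v} → Reach T u w → TAdj {n} T w v → Reach T u v

size : ∀ {n} → EdgeSet n → ℕ
size {n} T = foldr ℕ._+_ 0 (map (λ k → if T k then 1 else 0) (allFin (M n)))

SpanningTree : ∀ {n} → Graph n → Outcome n → EdgeSet n → Set
SpanningTree {n} G ω T =
  (∀ k → T k ≡ true → HEdge G ω k ≡ true) ×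
  (∀ u v → Reach {n} T u v) ×
  (size {n} T ≡ n ∸ 1)

signedSum : ∀ {n} → EdgeSet n → (Fin (M n) → Bool) → ℤ
signedSum {n} T χ =
  foldr ℤ._+_ (+ 0) (map (λ k → if T k then (if χ k then + 1 else -[1+ 0 ]) else + 0) (allFin (M n)))

-- Property: every ±1 colouring of E(H) has a spanning tree T of H with |Σχ| ≥ λ p n².
-- (A colouring is given on all slots; only its values on E(H) matter.)
Good : ∀ {n} → Graph n → ℚ → ℚ → Outcome n → Set
Good {n} G λ' p ω =
  ∀ (χ : Fin (M n) → Bool) → ∃ λ (T : EdgeSet n) → SpanningTree G ω T ×
    (λ' * p * ℕ→ℚ (n ℕ.* n) ≤ ∣ ℤ→ℚ (signedSum {n} T χ) ∣)

PerturbRange : (ℕ → ℚ) → Set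
PerturbRange p =
  (∀ n → 0ℚ ≤ p n × p n ≤ 1ℚ) ×
  (∀ (K : ℕ) → ∃ λ N → ∀ n → n ≥ N → ℕ→ℚ K ≤ p n * ℕ→ℚ (n ℕ.* n)) ×
  (∀ (ε : ℚ) → 0ℚ < ε → ∃ λ N → ∀ n → n ≥ N → p n * ℕ→ℚ n ≤ ε)

{-# OPTIONS --safe #-}
module Submission where

-- Put q = p n² and D = λ q. Kruskal's algorithm run on the red edges first yields a spanning tree with
-- signed sum n + 1 − 2c, where c is the number of red components. If this is below D for both colours,
-- let A and B be the unions of the red, respectively blue, components with at least αn/2 vertices. Each
-- has O(1/α) components and together they cover all vertices, so A ∩ B has at most 2D vertices, both
-- complements are linear in n, and no edge of H joins the complement of A to the complement of B.
-- Hence for v ∉ B and w ∉ A every random edge between N(v) and N(w) meets A ∩ B. As pn → 0, the random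
-- graph is almost a matching, so at most 6D such edges (counted with multiplicity) exist, which is less
-- than half of their expected number. By Chebyshev this is unlikely for a single pair (v , w), and by
-- averaging over all pairs it is unlikely to happen for a positive proportion of them. This avoids a
-- union bound over A and B, which depend on the colouring. The same argument shows that H is connected.

open import Defs
open import Algebra.Bundles using (CommutativeRing)
open import Data.Bool using (Bool; true; false; if_then_else_; _∨_; _∧_; not; T?)
import Data.Bool as Bool
import Data.Bool.Properties as Boolₚ
open import Data.Empty using (⊥; ⊥-elim)
open import Data.Fin using (Fin; zero; suc; _≟_; toℕ)
import Data.Fin.Properties as Finₚ
open import Data.Integer using (-[1+_])
import Data.Integer as ℤ
import Data.Integer.Properties as ℤₚ
open import Data.List using (List; []; _∷_; _++_; map; foldr; filter; filterᵇ; cartesianProduct; allFin; tabulate; lookup)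
open import Data.List.Membership.Propositional using (_∈_)
open import Data.List.Membership.Propositional.Properties using (∈-map⁻; ∈-filter⁺; ∈-filter⁻; ∈-cartesianProduct⁺; ∈-allFin)
import Data.List.Properties as Listₚ
open import Data.List.Relation.Unary.All using (All; []; _∷_)
import Data.List.Relation.Unary.All as All
import Data.List.Relation.Unary.All.Properties as Allₚ
open import Data.List.Relation.Unary.AllPairs using ([]; _∷_)
open import Data.List.Relation.Unary.Any using (here; there; index)
open import Data.List.Relation.Unary.Any.Properties using (lookup-index)
open import Data.List.Relation.Unary.Unique.Propositional using (Unique)
import Data.List.Relation.Unary.Unique.Propositional.Properties as Uniqueₚ
open import Data.Nat using (ℕ; zero; suc; _∸_; _<ᵇ_; _≥_)
import Data.Nat as ℕ
import Data.Nat.Properties as ℕₚ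
open import Data.Product using (∃; _×_; _,_; proj₁; proj₂)
open import Data.Rational using (ℚ; mkℚ; 0ℚ; 1ℚ; ½; _+_; _*_; _-_; -_; _≤_; _<_; _/_; ∣_∣; nonNegative; positive; toℚᵘ; ↥_; ↧ₙ_)
import Data.Rational.Properties as ℚₚ
open import Data.Rational.Solver using (module +-*-Solver)
import Data.Rational.Unnormalised as ℚᵘ
import Data.Rational.Unnormalised.Properties as ℚᵘₚ
open import Data.Sum using (_⊎_; inj₁; inj₂)
import Data.Sum as Sum
open import Data.Vec using (Vec; []; _∷_)
import Data.Vec as Vec
import Data.Vec.Properties as Vecₚ
open import Function using (_∘_)
open import Function.Bundles using (Equivalence)
open import Relation.Binary using (tri<; tri≈; tri>)
open import Relation.Binary.PropositionalEquality using (_≡_; refl; sym; trans; cong; cong₂; subst; module ≡-Reasoning)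
open import Relation.Nullary using (Dec; ¬_; yes; no; does)
open import Relation.Nullary.Decidable using (dec-true; dec-false)
open import Algebra.Properties.Semiring.Sum (CommutativeRing.semiring ℚₚ.+-*-commutativeRing) using (sum; sum-cong-≗; ∑-distrib-+; ∑-comm; *-distribˡ-sum; *-distribʳ-sum; sum-replicate-zero)
open +-*-Solver using (solve; _:=_; _:+_; _:*_; _:-_; :-_; con)

-- Ordered-field arithmetic

-- The standard format for the polynomial inequalities that follow: the gap `b - a` is written as an
-- explicit combination `s` of nonnegative quantities, so that only a ring identity is left to the
-- solver.
0≤⇒≤ : ∀ {a b s} → 0ℚ ≤ s → b - a ≡ s → a ≤ b
0≤⇒≤ {a} {b} {s} 0≤s eq =
  ℚₚ.≤-trans (ℚₚ.≤-reflexive (sym (ℚₚ.+-identityʳ a)))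
  (ℚₚ.≤-trans (ℚₚ.+-monoʳ-≤ a 0≤s)
  (ℚₚ.≤-reflexive (trans (cong (a +_) (sym eq)) (solve 2 (λ a b → a :+ (b :- a) := b) refl a b))))

≤⇒0≤ : ∀ {a b} → a ≤ b → 0ℚ ≤ b - a
≤⇒0≤ {a} {b} a≤b = ℚₚ.≤-trans (ℚₚ.≤-reflexive (sym (ℚₚ.+-inverseʳ a))) (ℚₚ.+-monoˡ-≤ (- a) a≤b)

infixl 6 _⊕_
infixl 7 _⊛_

_⊕_ : ∀ {a b} → 0ℚ ≤ a → 0ℚ ≤ b → 0ℚ ≤ a + b
p ⊕ q = ℚₚ.+-mono-≤ p q

*-monoˡ : ∀ {a b c} → 0ℚ ≤ a → b ≤ c → a * b ≤ a * c
*-monoˡ {a} 0≤a = ℚₚ.*-monoˡ-≤-nonNeg a {{nonNegative 0≤a}}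

*-monoʳ : ∀ {a b c} → 0ℚ ≤ a → b ≤ c → b * a ≤ c * a
*-monoʳ {a} 0≤a = ℚₚ.*-monoʳ-≤-nonNeg a {{nonNegative 0≤a}}

_⊛_ : ∀ {a b} → 0ℚ ≤ a → 0ℚ ≤ b → 0ℚ ≤ a * b
_⊛_ {a} p q = ℚₚ.≤-trans (ℚₚ.≤-reflexive (sym (ℚₚ.*-zeroʳ a))) (*-monoˡ p q)

0<* : ∀ {a b} → 0ℚ < a → 0ℚ < b → 0ℚ < a * b
0<* {a} {b} p q = ℚₚ.positive⁻¹ (a * b) {{ℚₚ.pos*pos⇒pos a {{positive p}} b {{positive q}}}}

*-mono : ∀ {a b c d} → 0ℚ ≤ a → 0ℚ ≤ c → a ≤ b → c ≤ d → a * c ≤ b * d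
*-mono 0≤a 0≤c a≤b c≤d = ℚₚ.≤-trans (*-monoˡ 0≤a c≤d) (*-monoʳ (ℚₚ.≤-trans 0≤c c≤d) a≤b)

*-cancel : ∀ {a b c} → 0ℚ < a → a * b ≤ a * c → b ≤ c
*-cancel {a} 0<a = ℚₚ.*-cancelˡ-≤-pos a {{positive 0<a}}

0≤square : ∀ a → 0ℚ ≤ a * a
0≤square a with ℚₚ.≤-total 0ℚ a
... | inj₁ p = p ⊛ p
... | inj₂ p = ℚₚ.≤-trans (q ⊛ q) (ℚₚ.≤-reflexive (solve 1 (λ a → (:- a) :* (:- a) := a :* a) refl a))
  where
  q : 0ℚ ≤ - a
  q = ℚₚ.neg-antimono-≤ p

a≤∣a∣ : ∀ a → a ≤ ∣ a ∣
a≤∣a∣ a with ℚₚ.≤-total 0ℚ a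
... | inj₁ p = ℚₚ.≤-reflexive (sym (ℚₚ.0≤p⇒∣p∣≡p p))
... | inj₂ p = ℚₚ.≤-trans p (ℚₚ.0≤∣p∣ a)

ℤ→ℚ-+ : ∀ a b → ℤ→ℚ (a ℤ.+ b) ≡ ℤ→ℚ a + ℤ→ℚ b
ℤ→ℚ-+ a b = ℚₚ.toℚᵘ-injective (ℚᵘₚ.≃-trans (ℚₚ.toℚᵘ-fromℚᵘ (ℚᵘ.mkℚᵘ (a ℤ.+ b) 0))
  (ℚᵘₚ.≃-sym (ℚᵘₚ.≃-trans (ℚₚ.toℚᵘ-homo-+ (ℤ→ℚ a) (ℤ→ℚ b))
  (ℚᵘₚ.≃-trans (ℚᵘₚ.+-cong (ℚₚ.toℚᵘ-fromℚᵘ (ℚᵘ.mkℚᵘ a 0)) (ℚₚ.toℚᵘ-fromℚᵘ (ℚᵘ.mkℚᵘ b 0)))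
  (ℚᵘ.*≡* (cong (ℤ._* ℤ.+ 1) (cong₂ ℤ._+_ (ℤₚ.*-identityʳ a) (ℤₚ.*-identityʳ b))))))))

ℤ→ℚ-* : ∀ a b → ℤ→ℚ (a ℤ.* b) ≡ ℤ→ℚ a * ℤ→ℚ b
ℤ→ℚ-* a b = ℚₚ.toℚᵘ-injective (ℚᵘₚ.≃-trans (ℚₚ.toℚᵘ-fromℚᵘ (ℚᵘ.mkℚᵘ (a ℤ.* b) 0))
  (ℚᵘₚ.≃-sym (ℚᵘₚ.≃-trans (ℚₚ.toℚᵘ-homo-* (ℤ→ℚ a) (ℤ→ℚ b))
  (ℚᵘₚ.*-cong (ℚₚ.toℚᵘ-fromℚᵘ (ℚᵘ.mkℚᵘ a 0)) (ℚₚ.toℚᵘ-fromℚᵘ (ℚᵘ.mkℚᵘ b 0))))))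

ℤ→ℚ-injective : ∀ {a b} → ℤ→ℚ a ≡ ℤ→ℚ b → a ≡ b
ℤ→ℚ-injective {a} {b} eq with ℚₚ.fromℚᵘ-injective {ℚᵘ.mkℚᵘ a 0} {ℚᵘ.mkℚᵘ b 0} eq
... | ℚᵘ.*≡* e = trans (sym (ℤₚ.*-identityʳ a)) (trans e (ℤₚ.*-identityʳ b))

ℕ→ℚ-+ : ∀ a b → ℕ→ℚ (a ℕ.+ b) ≡ ℕ→ℚ a + ℕ→ℚ b
ℕ→ℚ-+ a b = ℤ→ℚ-+ (ℤ.+ a) (ℤ.+ b)

ℕ→ℚ-* : ∀ a b → ℕ→ℚ (a ℕ.* b) ≡ ℕ→ℚ a * ℕ→ℚ b
ℕ→ℚ-* a b = trans (cong ℤ→ℚ (ℤₚ.pos-* a b)) (ℤ→ℚ-* (ℤ.+ a) (ℤ.+ b))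

ℕ→ℚ-injective : ∀ {a b} → ℕ→ℚ a ≡ ℕ→ℚ b → a ≡ b
ℕ→ℚ-injective eq = ℤₚ.+-injective (ℤ→ℚ-injective eq)

0≤ℕ→ℚ : ∀ n → 0ℚ ≤ ℕ→ℚ n
0≤ℕ→ℚ n = ℚₚ.nonNegative⁻¹ (ℕ→ℚ n) {{ℚₚ.normalize-nonNeg n 1}}

ℕ→ℚ-mono : ∀ {a b} → a ℕ.≤ b → ℕ→ℚ a ≤ ℕ→ℚ b
ℕ→ℚ-mono {b = b} ℕ.z≤n = 0≤ℕ→ℚ b
ℕ→ℚ-mono {suc a} {suc b} (ℕ.s≤s le) = ℚₚ.≤-trans (ℚₚ.≤-reflexive (ℕ→ℚ-+ 1 a))
  (ℚₚ.≤-trans (ℚₚ.+-monoʳ-≤ 1ℚ (ℕ→ℚ-mono le)) (ℚₚ.≤-reflexive (sym (ℕ→ℚ-+ 1 b))))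

denominator-* : ∀ x → ℕ→ℚ (↧ₙ x) * x ≡ ℤ→ℚ (↥ x)
denominator-* x@(mkℚ n d-1 _) = ℚₚ.toℚᵘ-injective (ℚᵘₚ.≃-trans (ℚₚ.toℚᵘ-homo-* (ℕ→ℚ (suc d-1)) x)
  (ℚᵘₚ.≃-trans (ℚᵘₚ.*-cong (ℚₚ.toℚᵘ-fromℚᵘ (ℚᵘ.mkℚᵘ (ℤ.+ suc d-1) 0)) (ℚᵘₚ.≃-refl {toℚᵘ x}))
  (ℚᵘₚ.≃-trans (ℚᵘ.*≡* (trans (ℤₚ.*-identityʳ _) (trans (ℤₚ.*-comm (ℤ.+ suc d-1) n) (cong (λ z → n ℤ.* ℤ.+ suc z) (sym (ℕₚ.+-identityʳ d-1))))))
  (ℚᵘₚ.≃-sym (ℚₚ.toℚᵘ-fromℚᵘ (ℚᵘ.mkℚᵘ n 0))))))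

≤-ℕ : ∀ y → ∃ λ m → y ≤ ℕ→ℚ m
≤-ℕ y@(mkℚ -[1+ n ] d c) = 0 , ℚₚ.nonPositive⁻¹ y
≤-ℕ y@(mkℚ (ℤ.+ n) d c) = n , ℚₚ.≤-trans (ℚₚ.≤-reflexive (sym (ℚₚ.*-identityˡ y)))
  (ℚₚ.≤-trans (*-monoʳ (ℚₚ.nonNegative⁻¹ y) (ℕ→ℚ-mono {1} {suc d} (ℕ.s≤s ℕ.z≤n))) (ℚₚ.≤-reflexive (denominator-* y)))

-- Multiplying a positive `x` by its denominator gives its numerator, an integer that is at least 1.
-- Hence `m` times the denominator is a suitable multiplier for any natural `m` above `y`.
archimedean : ∀ x y → 0ℚ < x → ∃ λ k → y ≤ ℕ→ℚ k * x
archimedean x@(mkℚ (ℤ.+ 0) d c) y 0<x = ⊥-elim (ℚₚ.<-irrefl (sym (ℚₚ.↥p≡0⇒p≡0 x refl)) 0<x)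
archimedean x@(mkℚ -[1+ n ] d c) y 0<x = ⊥-elim (ℚₚ.<-asym 0<x (ℚₚ.negative⁻¹ x))
archimedean x@(mkℚ (ℤ.+ suc n) d c) y 0<x = m ℕ.* suc d , (begin
  y                          ≤⟨ proj₂ (≤-ℕ y) ⟩
  ℕ→ℚ m                      ≡⟨ ℚₚ.*-identityʳ (ℕ→ℚ m) ⟨
  ℕ→ℚ m * 1ℚ                 ≤⟨ *-monoˡ (0≤ℕ→ℚ m) (ℕ→ℚ-mono {1} {suc n} (ℕ.s≤s ℕ.z≤n)) ⟩
  ℕ→ℚ m * ℕ→ℚ (suc n)        ≡⟨ cong (ℕ→ℚ m *_) (denominator-* x) ⟨
  ℕ→ℚ m * (ℕ→ℚ (suc d) * x)  ≡⟨ ℚₚ.*-assoc (ℕ→ℚ m) _ x ⟨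
  ℕ→ℚ m * ℕ→ℚ (suc d) * x    ≡⟨ cong (_* x) (ℕ→ℚ-* m (suc d)) ⟨
  ℕ→ℚ (m ℕ.* suc d) * x      ∎)
  where
  open ℚₚ.≤-Reasoning
  m = proj₁ (≤-ℕ y)

-- Finite sums

𝟙 : Bool → ℚ
𝟙 b = if b then 1ℚ else 0ℚ

# : ∀ {n} → (Fin n → Bool) → ℚ
# A = sum (λ v → 𝟙 (A v))

0≤𝟙 : ∀ b → 0ℚ ≤ 𝟙 b
0≤𝟙 true  = 0≤ℕ→ℚ 1
0≤𝟙 false = ℚₚ.≤-refl

𝟙≤1 : ∀ b → 𝟙 b ≤ 1ℚ
𝟙≤1 true  = ℚₚ.≤-refl
𝟙≤1 false = 0≤ℕ→ℚ 1

sum-mono : ∀ {n} {f g : Fin n → ℚ} → (∀ i → f i ≤ g i) → sum f ≤ sum g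
sum-mono {zero}  f≤g = ℚₚ.≤-refl
sum-mono {suc n} f≤g = ℚₚ.+-mono-≤ (f≤g zero) (sum-mono (f≤g ∘ suc))

0≤sum : ∀ {n} {f : Fin n → ℚ} → (∀ i → 0ℚ ≤ f i) → 0ℚ ≤ sum f
0≤sum {n} 0≤f = ℚₚ.≤-trans (ℚₚ.≤-reflexive (sym (sum-replicate-zero n))) (sum-mono 0≤f)

term≤sum : ∀ {n} {f : Fin n → ℚ} → (∀ i → 0ℚ ≤ f i) → ∀ i → f i ≤ sum f
term≤sum {f = f} 0≤f zero = ℚₚ.≤-trans (ℚₚ.≤-reflexive (sym (ℚₚ.+-identityʳ (f zero)))) (ℚₚ.+-monoʳ-≤ (f zero) (0≤sum (0≤f ∘ suc)))
term≤sum {f = f} 0≤f (suc i) = ℚₚ.≤-trans (term≤sum (0≤f ∘ suc) i)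
  (ℚₚ.≤-trans (ℚₚ.≤-reflexive (sym (ℚₚ.+-identityˡ _))) (ℚₚ.+-monoˡ-≤ _ (0≤f zero)))

sum-const : ∀ n c → sum {n} (λ _ → c) ≡ ℕ→ℚ n * c
sum-const zero c = sym (ℚₚ.*-zeroˡ c)
sum-const (suc n) c = trans (cong (c +_) (sum-const n c))
  (trans (solve 2 (λ c m → c :+ m :* c := (con 1ℚ :+ m) :* c) refl c (ℕ→ℚ n)) (cong (_* c) (sym (ℕ→ℚ-+ 1 n))))

sum-1 : ∀ n → sum {n} (λ _ → 1ℚ) ≡ ℕ→ℚ n
sum-1 n = trans (sum-const n 1ℚ) (ℚₚ.*-identityʳ (ℕ→ℚ n))

sum-- : ∀ {n} (f g : Fin n → ℚ) → sum (λ i → f i - g i) ≡ sum f - sum g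
sum-- {zero} f g = refl
sum-- {suc n} f g = trans (cong (f zero - g zero +_) (sum-- (f ∘ suc) (g ∘ suc)))
  (solve 4 (λ a b c d → (a :- b) :+ (c :- d) := (a :+ c) :- (b :+ d)) refl (f zero) (g zero) (sum (f ∘ suc)) (sum (g ∘ suc)))

sum-neg : ∀ {n} (f : Fin n → ℚ) → sum (λ i → - f i) ≡ - sum f
sum-neg {zero} f = refl
sum-neg {suc n} f = trans (cong (- f zero +_) (sum-neg (f ∘ suc))) (sym (ℚₚ.neg-distrib-+ (f zero) _))

-- Degrees, edge counts and signed sums are defined by folds in ℕ or ℤ. An additive map `φ` into ℚ
-- carries all of them to `sum`, where the linear algebra takes place.
foldr-allFin : ∀ {n} {A : Set} (_∙_ : A → A → A) (ε : A) (φ : A → ℚ) → (∀ a b → φ (a ∙ b) ≡ φ a + φ b) → φ ε ≡ 0ℚ →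
  (f : Fin n → A) → φ (foldr _∙_ ε (map f (allFin n))) ≡ sum (φ ∘ f)
foldr-allFin {n} _∙_ ε φ φ-∙ φ-ε f = trans (cong (φ ∘ foldr _∙_ ε) (Listₚ.map-tabulate (λ i → i) f)) (go f)
  where
  go : ∀ {n} (f : Fin n → _) → φ (foldr _∙_ ε (tabulate f)) ≡ sum (φ ∘ f)
  go {zero} f = φ-ε
  go {suc n} f = trans (φ-∙ (f zero) _) (cong (φ (f zero) +_) (go (f ∘ suc)))

≡ᵇ : ∀ {n} → Fin n → Fin n → Bool
≡ᵇ u v = does (u ≟ v)

≡ᵇ-refl : ∀ {n} (u : Fin n) → ≡ᵇ u u ≡ true
≡ᵇ-refl u = dec-true (u ≟ u) refl

≡ᵇ-false : ∀ {n} {u v : Fin n} → ¬ u ≡ v → ≡ᵇ u v ≡ false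
≡ᵇ-false {u = u} {v} = dec-false (u ≟ v)

#-singleton : ∀ {n} (u : Fin n) → # (λ v → ≡ᵇ v u) ≡ 1ℚ
#-singleton {suc n} zero = trans (cong (1ℚ +_) (sum-replicate-zero n)) refl
#-singleton {suc n} (suc u) = trans (ℚₚ.+-identityˡ _) (#-singleton u)

#-singleton′ : ∀ {n} (u : Fin n) → # (≡ᵇ u) ≡ 1ℚ
#-singleton′ {suc n} zero = trans (cong (1ℚ +_) (sum-replicate-zero n)) refl
#-singleton′ {suc n} (suc u) = trans (ℚₚ.+-identityˡ _) (#-singleton′ u)

-- Expectation on the product space

-- Conditioning on the first coin replaces a sum over all outcomes, so that moments are computed by
-- induction on the number of coins. The link with `weight` is made in `weight-outcomes`.
E : ∀ {m} → ℚ → (Vec Bool m → ℚ) → ℚ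
E {zero}  p f = f []
E {suc m} p f = p * E p (f ∘ (true ∷_)) + (1ℚ - p) * E p (f ∘ (false ∷_))

E-cong : ∀ {m} p {f g : Vec Bool m → ℚ} → (∀ ω → f ω ≡ g ω) → E p f ≡ E p g
E-cong {zero}  p f≡g = f≡g []
E-cong {suc m} p f≡g = cong₂ (λ x y → p * x + (1ℚ - p) * y) (E-cong p (f≡g ∘ (true ∷_))) (E-cong p (f≡g ∘ (false ∷_)))

E-+ : ∀ {m} p (f g : Vec Bool m → ℚ) → E p (λ ω → f ω + g ω) ≡ E p f + E p g
E-+ {zero}  p f g = refl
E-+ {suc m} p f g =
  trans (cong₂ (λ x y → p * x + (1ℚ - p) * y) (E-+ p (f ∘ (true ∷_)) (g ∘ (true ∷_))) (E-+ p (f ∘ (false ∷_)) (g ∘ (false ∷_))))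
  (solve 6 (λ p q a b c d → p :* (a :+ b) :+ q :* (c :+ d) := (p :* a :+ q :* c) :+ (p :* b :+ q :* d)) refl
    p (1ℚ - p) (E p (f ∘ (true ∷_))) (E p (g ∘ (true ∷_))) (E p (f ∘ (false ∷_))) (E p (g ∘ (false ∷_))))

E-* : ∀ {m} p c (f : Vec Bool m → ℚ) → E p (λ ω → c * f ω) ≡ c * E p f
E-* {zero}  p c f = refl
E-* {suc m} p c f =
  trans (cong₂ (λ x y → p * x + (1ℚ - p) * y) (E-* p c (f ∘ (true ∷_))) (E-* p c (f ∘ (false ∷_))))
  (solve 5 (λ p q c x y → p :* (c :* x) :+ q :* (c :* y) := c :* (p :* x :+ q :* y)) refl
    p (1ℚ - p) c (E p (f ∘ (true ∷_))) (E p (f ∘ (false ∷_))))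

E-const : ∀ {m} p c → E {m} p (λ _ → c) ≡ c
E-const {zero}  p c = refl
E-const {suc m} p c =
  trans (cong₂ (λ x y → p * x + (1ℚ - p) * y) (E-const {m} p c) (E-const {m} p c))
  (solve 2 (λ p c → p :* c :+ (con 1ℚ :- p) :* c := c) refl p c)

E-mono : ∀ {m} {p} → 0ℚ ≤ p → p ≤ 1ℚ → {f g : Vec Bool m → ℚ} → (∀ ω → f ω ≤ g ω) → E p f ≤ E p g
E-mono {zero}  0≤p p≤1 f≤g = f≤g []
E-mono {suc m} 0≤p p≤1 f≤g = ℚₚ.+-mono-≤ (*-monoˡ 0≤p (E-mono 0≤p p≤1 (f≤g ∘ (true ∷_))))
  (*-monoˡ (≤⇒0≤ p≤1) (E-mono 0≤p p≤1 (f≤g ∘ (false ∷_))))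

E-sum : ∀ {m n} p (f : Fin n → Vec Bool m → ℚ) → E p (λ ω → sum (λ i → f i ω)) ≡ sum (λ i → E p (f i))
E-sum {m} {zero}  p f = E-const {m} p 0ℚ
E-sum {m} {suc n} p f = trans (E-+ p (f zero) (λ ω → sum (λ i → f (suc i) ω))) (cong (E p (f zero) +_) (E-sum p (f ∘ suc)))

-- Expanding a square around a constant gives a constant, a linear term and the square of the random
-- variable; second moments, variances and cherry counts all reduce to this shape.
E-affine : ∀ {m} p a b (f g : Vec Bool m → ℚ) → E p (λ ω → (a + b * f ω) + g ω) ≡ (a + b * E p f) + E p g
E-affine {m} p a b f g = trans (E-+ p (λ ω → a + b * f ω) g)
  (cong (_+ E p g) (trans (E-+ p (λ _ → a) (λ ω → b * f ω)) (cong₂ _+_ (E-const {m} p a) (E-* p b f))))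

lin : ∀ {m} → (Fin m → ℚ) → Vec Bool m → ℚ
lin c ω = sum (λ k → c k * 𝟙 (Vec.lookup ω k))

E-lin : ∀ {m} p (c : Fin m → ℚ) → E p (lin c) ≡ p * sum c
E-lin {zero}  p c = sym (ℚₚ.*-zeroʳ p)
E-lin {suc m} p c = trans
  (cong₂ (λ x y → p * x + (1ℚ - p) * y) (shift (c zero * 1ℚ)) (shift (c zero * 0ℚ)))
  (solve 3 (λ p a s → p :* (a :* con 1ℚ :+ p :* s) :+ (con 1ℚ :- p) :* (a :* con 0ℚ :+ p :* s) := p :* (a :+ s)) refl p (c zero) (sum (c ∘ suc)))
  where
  shift : ∀ a → E p (λ ω → a + lin (c ∘ suc) ω) ≡ a + p * sum (c ∘ suc)
  shift a = trans (E-+ p (λ _ → a) (lin (c ∘ suc))) (cong₂ _+_ (E-const {m} p a) (E-lin p (c ∘ suc)))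

-- Squared mean plus variance of a weighted sum of independent coins. Once the first coin is fixed,
-- the square of a shifted sum only involves the first two moments of the remaining coins.
E-lin² : ∀ {m} p (c : Fin m → ℚ) →
  E p (λ ω → lin c ω * lin c ω) ≡ p * sum c * (p * sum c) + p * (1ℚ - p) * sum (λ k → c k * c k)
E-lin² {zero}  p c = solve 1 (λ p → con 0ℚ := p :* con 0ℚ :* (p :* con 0ℚ) :+ p :* (con 1ℚ :- p) :* con 0ℚ) refl p
E-lin² {suc m} p c = trans
  (cong₂ (λ x y → p * x + (1ℚ - p) * y) (shift (c zero * 1ℚ)) (shift (c zero * 0ℚ)))
  (solve 4 (λ p a s t →
      let e = λ b → b :* b :+ (con 1ℚ :+ con 1ℚ) :* b :* (p :* s) :+ (p :* s :* (p :* s) :+ p :* (con 1ℚ :- p) :* t) in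
      p :* e (a :* con 1ℚ) :+ (con 1ℚ :- p) :* e (a :* con 0ℚ)
      := p :* (a :+ s) :* (p :* (a :+ s)) :+ p :* (con 1ℚ :- p) :* (a :* a :+ t)) refl
    p (c zero) (sum (c ∘ suc)) (sum (λ k → c (suc k) * c (suc k))))
  where
  S = sum (c ∘ suc)
  L = lin (c ∘ suc)
  shift : ∀ a → E p (λ ω → (a + L ω) * (a + L ω)) ≡
    a * a + (1ℚ + 1ℚ) * a * (p * S) + (p * S * (p * S) + p * (1ℚ - p) * sum (λ k → c (suc k) * c (suc k)))
  shift a = trans (E-cong p (λ ω → solve 2 (λ a l → (a :+ l) :* (a :+ l) := (a :* a :+ (con 1ℚ :+ con 1ℚ) :* a :* l) :+ l :* l) refl a (L ω)))
    (trans (E-affine p (a * a) ((1ℚ + 1ℚ) * a) L (λ ω → L ω * L ω))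
    (cong₂ (λ x y → a * a + (1ℚ + 1ℚ) * a * x + y) (E-lin p (c ∘ suc)) (E-lin² p (c ∘ suc))))

variance-lin : ∀ {m} p (c : Fin m → ℚ) →
  E p (λ ω → (lin c ω - p * sum c) * (lin c ω - p * sum c)) ≡ p * (1ℚ - p) * sum (λ k → c k * c k)
variance-lin p c = trans (E-cong p (λ ω → solve 2 (λ l μ → (l :- μ) :* (l :- μ) := (μ :* μ :+ (:- (con 1ℚ :+ con 1ℚ) :* μ) :* l) :+ l :* l) refl (lin c ω) μ))
  (trans (E-affine p (μ * μ) (- (1ℚ + 1ℚ) * μ) (lin c) (λ ω → lin c ω * lin c ω))
  (trans (cong₂ (λ x y → μ * μ + - (1ℚ + 1ℚ) * μ * x + y) (E-lin p c) (E-lin² p c))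
  (solve 2 (λ μ v → μ :* μ :+ :- (con 1ℚ :+ con 1ℚ) :* μ :* μ :+ (μ :* μ :+ v) := v) refl μ (p * (1ℚ - p) * sum (λ k → c k * c k)))))
  where
  μ = p * sum c

-- Lists of outcomes and Markov's inequality

lsum : ∀ {A : Set} → (A → ℚ) → List A → ℚ
lsum f xs = foldr _+_ 0ℚ (map f xs)

lsum-++ : ∀ {A : Set} (f : A → ℚ) xs ys → lsum f (xs ++ ys) ≡ lsum f xs + lsum f ys
lsum-++ f []       ys = sym (ℚₚ.+-identityˡ _)
lsum-++ f (x ∷ xs) ys = trans (cong (f x +_) (lsum-++ f xs ys)) (sym (ℚₚ.+-assoc (f x) _ _))

-- `ProbAtLeast` asks for a duplicate-free list of outcomes; this enumeration of a decidable event
-- is the witness, and its total weight is the expectation of the indicator.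
outcomes : ∀ {m} → (Vec Bool m → Bool) → List (Vec Bool m)
outcomes {zero}  P = if P [] then [] ∷ [] else []
outcomes {suc m} P = map (true ∷_) (outcomes (P ∘ (true ∷_))) ++ map (false ∷_) (outcomes (P ∘ (false ∷_)))

outcomes-all : ∀ {m} (P : Vec Bool m → Bool) → All (λ ω → P ω ≡ true) (outcomes P)
outcomes-all {zero} P with P [] in eq
... | true  = eq ∷ []
... | false = []
outcomes-all {suc m} P = Allₚ.++⁺ (Allₚ.map⁺ (outcomes-all (P ∘ (true ∷_)))) (Allₚ.map⁺ (outcomes-all (P ∘ (false ∷_))))

outcomes-unique : ∀ {m} (P : Vec Bool m → Bool) → Unique (outcomes P)
outcomes-unique {zero} P with P []
... | true  = [] ∷ []
... | false = []
outcomes-unique {suc m} P = Uniqueₚ.++⁺ (Uniqueₚ.map⁺ Vecₚ.∷-injectiveʳ (outcomes-unique (P ∘ (true ∷_))))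
  (Uniqueₚ.map⁺ Vecₚ.∷-injectiveʳ (outcomes-unique (P ∘ (false ∷_))))
  (λ (∈t , ∈f) → disjoint (proj₂ (proj₂ (∈-map⁻ _ ∈t))) (proj₂ (proj₂ (∈-map⁻ _ ∈f))))
  where
  disjoint : ∀ {v w : Vec Bool m} {u} → u ≡ true ∷ v → u ≡ false ∷ w → ⊥
  disjoint refl ()

lsum-weight-∷ : ∀ {m} p b (xs : List (Vec Bool m)) →
  lsum (weight p) (map (b ∷_) xs) ≡ (if b then p else (1ℚ - p)) * lsum (weight p) xs
lsum-weight-∷ p b []       = sym (ℚₚ.*-zeroʳ (if b then p else (1ℚ - p)))
lsum-weight-∷ p b (x ∷ xs) = trans (cong ((if b then p else (1ℚ - p)) * weight p x +_) (lsum-weight-∷ p b xs))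
  (sym (ℚₚ.*-distribˡ-+ (if b then p else (1ℚ - p)) (weight p x) (lsum (weight p) xs)))

weight-outcomes : ∀ {m} p (P : Vec Bool m → Bool) → lsum (weight p) (outcomes P) ≡ E p (𝟙 ∘ P)
weight-outcomes {zero} p P with P []
... | true  = refl
... | false = refl
weight-outcomes {suc m} p P = trans (lsum-++ (weight p) (map (true ∷_) (outcomes (P ∘ (true ∷_)))) _)
  (cong₂ _+_ (trans (lsum-weight-∷ p true (outcomes (P ∘ (true ∷_)))) (cong (p *_) (weight-outcomes p (P ∘ (true ∷_)))))
             (trans (lsum-weight-∷ p false (outcomes (P ∘ (false ∷_)))) (cong ((1ℚ - p) *_) (weight-outcomes p (P ∘ (false ∷_))))))

-- The variable `t` times the indicator of the complement of `P` lies below `W` pointwise; taking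
-- expectations and cancelling `t` bounds the probability of the complement by `ε`.
markov : ∀ {m} {p} → 0ℚ ≤ p → p ≤ 1ℚ → (W : Vec Bool m → ℚ) (P : Vec Bool m → Bool) {t ε : ℚ} → 0ℚ < t →
  (∀ ω → 0ℚ ≤ W ω) → (∀ ω → P ω ≡ false → t ≤ W ω) → E p W ≤ ε * t → 1ℚ - ε ≤ E p (𝟙 ∘ P)
markov {m} {p} 0≤p p≤1 W P {t} {ε} 0<t 0≤W t≤W EW≤ = 0≤⇒≤ (≤⇒0≤ (*-cancel 0<t bound))
  (solve 2 (λ e x → x :- (con 1ℚ :- e) := e :- (con 1ℚ :- x)) refl ε (E p (𝟙 ∘ P)))
  where
  pointwise : ∀ ω → t + (- t) * 𝟙 (P ω) ≤ W ω
  pointwise ω with P ω in eq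
  ... | true  = ℚₚ.≤-trans (ℚₚ.≤-reflexive (solve 1 (λ t → t :+ (:- t) :* con 1ℚ := con 0ℚ) refl t)) (0≤W ω)
  ... | false = ℚₚ.≤-trans (ℚₚ.≤-reflexive (solve 1 (λ t → t :+ (:- t) :* con 0ℚ := t) refl t)) (t≤W ω eq)
  bound : t * (1ℚ - E p (𝟙 ∘ P)) ≤ t * ε
  bound = begin
    t * (1ℚ - E p (𝟙 ∘ P))              ≡⟨ solve 2 (λ t x → t :* (con 1ℚ :- x) := t :+ (:- t) :* x) refl t (E p (𝟙 ∘ P)) ⟩
    t + (- t) * E p (𝟙 ∘ P)             ≡⟨ cong₂ _+_ (E-const {m} p t) (E-* p (- t) (𝟙 ∘ P)) ⟨
    E {m} p (λ _ → t) + E p (λ ω → (- t) * 𝟙 (P ω))  ≡⟨ E-+ p (λ _ → t) (λ ω → (- t) * 𝟙 (P ω)) ⟨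
    E p (λ ω → t + (- t) * 𝟙 (P ω))     ≤⟨ E-mono 0≤p p≤1 pointwise ⟩
    E p W                               ≤⟨ EW≤ ⟩
    ε * t                               ≡⟨ ℚₚ.*-comm ε t ⟩
    t * ε                               ∎
    where open ℚₚ.≤-Reasoning

-- Maximal forests

lo hi : ∀ {n} → Fin (M n) → Fin n
lo {n} k = proj₁ (lookup (pairs n) k)
hi {n} k = proj₂ (lookup (pairs n) k)

reach-trans : ∀ {n} {T : EdgeSet n} {u v w} → Reach {n} T u v → Reach {n} T v w → Reach {n} T u w
reach-trans r here       = r
reach-trans r (step s e) = step (reach-trans r s) e

TAdj-sym : ∀ {n} {T : EdgeSet n} {u v} → TAdj {n} T u v → TAdj {n} T v u
TAdj-sym (k , Tk , inj₁ e) = k , Tk , inj₂ e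
TAdj-sym (k , Tk , inj₂ e) = k , Tk , inj₁ e

reach-sym : ∀ {n} {T : EdgeSet n} {u v} → Reach {n} T u v → Reach {n} T v u
reach-sym here = here
reach-sym {n} {T} (step r e) = reach-trans (step here (TAdj-sym {n} {T} e)) (reach-sym r)

reach-mono : ∀ {n} {T T′ : EdgeSet n} → (∀ k → T k ≡ true → T′ k ≡ true) → ∀ {u v} → Reach {n} T u v → Reach {n} T′ u v
reach-mono T⊆T′ here = here
reach-mono T⊆T′ (step r (k , Tk , e)) = step (reach-mono T⊆T′ r) (k , T⊆T′ k Tk , e)

wsum : ∀ {n} → EdgeSet n → (Fin (M n) → ℚ) → ℚ
wsum T w = sum (λ k → 𝟙 (T k) * w k)

roots : ∀ {n} → (Fin n → Fin n) → ℚ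
roots f = # (λ x → ≡ᵇ (f x) x)

-- f sends every vertex to the chosen root of its tree in the forest T.
record Forest {n} (T : EdgeSet n) (f : Fin n → Fin n) : Set where
  field
    idem   : ∀ v → f (f v) ≡ f v
    reach  : ∀ v → Reach {n} T v (f v)
    joined : ∀ k → T k ≡ true → f (lo k) ≡ f (hi k)

open Forest

-- The result of offering the edges `ks` to a forest in turn. Apart from being a forest again it
-- records what two successive phases need: offered edges end up inside trees, earlier trees stay
-- together, and no foreign edge enters.
record Extension {n} (ks : List (Fin (M n))) (T : EdgeSet n) (f : Fin n → Fin n) : Set where
  field
    T′      : EdgeSet n
    f′      : Fin n → Fin n
    forest  : Forest {n} T′ f′
    closed  : ∀ {k} → k ∈ ks → f′ (lo k) ≡ f′ (hi k)
    coarser : ∀ {u v} → f u ≡ f v → f′ u ≡ f′ v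
    edges   : ∀ k → T′ k ≡ true → T k ≡ true ⊎ k ∈ ks
    -- Each accepted edge adds `c` to the weight and removes one root, so this combination is
    -- invariant when all offered edges have the same weight `c`.
    balance : ∀ w c → (∀ {k} → k ∈ ks → w k ≡ c) → wsum {n} T′ w + c * roots f′ ≡ wsum {n} T w + c * roots f

add : ∀ {m} → Fin m → (Fin m → Bool) → Fin m → Bool
add k T l = ≡ᵇ l k ∨ T l

merge : ∀ {n} → (Fin n → Fin n) → Fin n → Fin n → Fin n → Fin n
merge f x y w = if ≡ᵇ (f w) y then x else f w

wsum-add : ∀ {n} (T : EdgeSet n) k w → T k ≡ false → wsum {n} (add k T) w ≡ wsum {n} T w + w k
wsum-add {n} T k w k∉T = begin
  wsum {n} (add k T) w                                     ≡⟨ sum-cong-≗ pointwise ⟩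
  sum (λ l → 𝟙 (T l) * w l + 𝟙 (≡ᵇ l k) * w k)             ≡⟨ ∑-distrib-+ (λ l → 𝟙 (T l) * w l) (λ l → 𝟙 (≡ᵇ l k) * w k) ⟩
  wsum {n} T w + sum (λ l → 𝟙 (≡ᵇ l k) * w k)              ≡⟨ cong (wsum {n} T w +_) (*-distribʳ-sum (w k) (λ l → 𝟙 (≡ᵇ l k))) ⟨
  wsum {n} T w + # (λ l → ≡ᵇ l k) * w k                    ≡⟨ cong (λ s → wsum {n} T w + s * w k) (#-singleton k) ⟩
  wsum {n} T w + 1ℚ * w k                                  ≡⟨ cong (wsum {n} T w +_) (ℚₚ.*-identityˡ (w k)) ⟩
  wsum {n} T w + w k                                       ∎
  where
  open ≡-Reasoning
  pointwise : ∀ l → 𝟙 (add k T l) * w l ≡ 𝟙 (T l) * w l + 𝟙 (≡ᵇ l k) * w k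
  pointwise l with l ≟ k
  ... | yes refl rewrite k∉T = solve 1 (λ x → con 1ℚ :* x := con 0ℚ :* x :+ con 1ℚ :* x) refl (w k)
  ... | no  _    = solve 2 (λ x y → x := x :+ con 0ℚ :* y) refl (𝟙 (T l) * w l) (w k)

-- Exactly `y` stops being a root. Any other vertex sent to `y` was no root before, and it is none
-- afterwards, since `x` itself is not sent to `y`.
roots-merge : ∀ {n} (f : Fin n → Fin n) x y → f x ≡ x → f y ≡ y → ¬ x ≡ y → roots (merge f x y) + 1ℚ ≡ roots f
roots-merge {n} f x y fx fy x≢y = begin
  roots (merge f x y) + 1ℚ                                   ≡⟨ cong (roots (merge f x y) +_) (#-singleton y) ⟨
  roots (merge f x y) + # (λ z → ≡ᵇ z y)                     ≡⟨ ∑-distrib-+ (λ z → 𝟙 (≡ᵇ (merge f x y z) z)) (λ z → 𝟙 (≡ᵇ z y)) ⟨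
  sum (λ z → 𝟙 (≡ᵇ (merge f x y z) z) + 𝟙 (≡ᵇ z y))          ≡⟨ sum-cong-≗ pointwise ⟩
  roots f                                                    ∎
  where
  open ≡-Reasoning
  pointwise : ∀ z → 𝟙 (≡ᵇ (merge f x y z) z) + 𝟙 (≡ᵇ z y) ≡ 𝟙 (≡ᵇ (f z) z)
  pointwise z with f z ≟ y
  ... | no fz≢y rewrite ≡ᵇ-false {u = z} {y} (λ z≡y → fz≢y (trans (cong f z≡y) fy)) = ℚₚ.+-identityʳ _
  ... | yes fz≡y rewrite ≡ᵇ-false {u = x} {z} (λ x≡z → x≢y (trans (sym fx) (trans (cong f x≡z) fz≡y))) | fz≡y with z ≟ y
  ...   | yes refl rewrite ≡ᵇ-refl z = refl
  ...   | no  z≢y  rewrite ≡ᵇ-false {u = y} {z} (z≢y ∘ sym) = refl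

-- An edge is skipped if its ends already have the same root; otherwise it is added and the tree of
-- its upper end is redirected to the root of its lower end.
extend : ∀ {n} ks {T f} → Forest {n} T f → Extension {n} ks T f
extend [] {T} {f} F = record
  { T′ = T ; f′ = f ; forest = F ; closed = λ () ; coarser = λ e → e ; edges = λ _ → inj₁ ; balance = λ _ _ _ → refl }
extend {n} (k ∷ ks) {T} {f} F with f (lo k) ≟ f (hi k)
... | yes e = record
  { T′ = T′ ; f′ = f′ ; forest = forest
  ; closed  = λ { (here refl) → coarser e ; (there k∈) → closed k∈ }
  ; coarser = coarser
  ; edges   = λ l l∈ → Sum.map₂ there (edges l l∈)
  ; balance = λ w c wc → balance w c (wc ∘ there) }
  where open Extension (extend {n} ks F)
... | no lo≢hi = record
  { T′ = T′ ; f′ = f′ ; forest = forest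
  ; closed  = λ { (here refl) → coarser g-lo≡g-hi ; (there k∈) → closed k∈ }
  ; coarser = λ e → coarser (cong (λ z → if ≡ᵇ z y then x else z) e)
  ; edges   = λ l l∈ → edges′ l (edges l l∈)
  ; balance = λ w c wc → trans (balance w c (wc ∘ there)) (step-balance w c (wc (here refl))) }
  where
  x = f (lo k)
  y = f (hi k)
  S = add k T
  g = merge f x y
  -- An edge of the forest has both ends in one tree, so the accepted edge is new and its weight is
  -- not counted twice.
  k∉T : T k ≡ false
  k∉T = Boolₚ.¬-not (lo≢hi ∘ joined F k)
  T⊆S : ∀ l → T l ≡ true → S l ≡ true
  T⊆S l l∈ = trans (cong (≡ᵇ l k ∨_) l∈) (Boolₚ.∨-zeroʳ _)
  g-lo≡g-hi : g (lo k) ≡ g (hi k)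
  g-lo≡g-hi rewrite ≡ᵇ-false lo≢hi | ≡ᵇ-refl (f (hi k)) = refl
  k∈S : S k ≡ true
  k∈S = cong (_∨ T k) (≡ᵇ-refl k)
  G : Forest {n} S g
  G .idem v with f v ≟ y
  ... | yes _ rewrite idem F (lo k) | ≡ᵇ-false lo≢hi = refl
  ... | no fv≢y rewrite idem F v | ≡ᵇ-false fv≢y = refl
  G .reach v with f v ≟ y
  ... | no _ = reach-mono T⊆S (reach F v)
  -- The path runs from `v` to its old root `y`, back to the upper end of `k`, across `k`, and from
  -- the lower end to the new root `x`.
  ... | yes fv≡y = reach-trans (reach-mono T⊆S (reach-trans (subst (Reach {n} T v) fv≡y (reach F v)) (reach-sym (reach F (hi k)))))
      (reach-trans (step here (k , k∈S , inj₂ refl)) (reach-mono T⊆S (reach F (lo k))))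
  G .joined l l∈ with l ≟ k
  ... | yes refl = g-lo≡g-hi
  ... | no  _    = cong (λ z → if ≡ᵇ z y then x else z) (joined F l l∈)
  open Extension (extend {n} ks G)
  edges′ : ∀ l → S l ≡ true ⊎ l ∈ ks → T l ≡ true ⊎ l ∈ k ∷ ks
  edges′ l (inj₂ l∈) = inj₂ (there l∈)
  edges′ l (inj₁ l∈) with l ≟ k
  ... | yes l≡k = inj₂ (here l≡k)
  ... | no  _   = inj₁ l∈
  step-balance : ∀ w c → w k ≡ c → wsum {n} S w + c * roots g ≡ wsum {n} T w + c * roots f
  step-balance w c wk = begin
    wsum {n} S w + c * roots g          ≡⟨ cong (_+ c * roots g) (wsum-add {n} T k w k∉T) ⟩
    wsum {n} T w + w k + c * roots g    ≡⟨ cong (λ z → wsum {n} T w + z + c * roots g) wk ⟩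
    wsum {n} T w + c + c * roots g      ≡⟨ solve 3 (λ s c r → s :+ c :+ c :* r := s :+ c :* (r :+ con 1ℚ)) refl (wsum {n} T w) c (roots g) ⟩
    wsum {n} T w + c * (roots g + 1ℚ)   ≡⟨ cong (λ z → wsum {n} T w + c * z) (roots-merge f x y (idem F (lo k)) (idem F (hi k)) lo≢hi) ⟩
    wsum {n} T w + c * roots f          ∎
    where open ≡-Reasoning

-- Spanning trees biased towards one colour

sign : Bool → ℚ
sign b = if b then 1ℚ else - 1ℚ

size-wsum : ∀ {n} (T : EdgeSet n) → ℕ→ℚ (size {n} T) ≡ wsum {n} T (λ _ → 1ℚ)
size-wsum {n} T = trans (foldr-allFin ℕ._+_ 0 ℕ→ℚ ℕ→ℚ-+ refl (λ k → if T k then 1 else 0)) (sum-cong-≗ pointwise)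
  where
  pointwise : ∀ k → ℕ→ℚ (if T k then 1 else 0) ≡ 𝟙 (T k) * 1ℚ
  pointwise k with T k
  ... | true  = refl
  ... | false = refl

signedSum-wsum : ∀ {n} (T : EdgeSet n) χ → ℤ→ℚ (signedSum {n} T χ) ≡ wsum {n} T (sign ∘ χ)
signedSum-wsum {n} T χ = trans (foldr-allFin ℤ._+_ (ℤ.+ 0) ℤ→ℚ ℤ→ℚ-+ refl (λ k → if T k then (if χ k then ℤ.+ 1 else -[1+ 0 ]) else ℤ.+ 0)) (sum-cong-≗ pointwise)
  where
  pointwise : ∀ k → ℤ→ℚ (if T k then (if χ k then ℤ.+ 1 else -[1+ 0 ]) else ℤ.+ 0) ≡ 𝟙 (T k) * sign (χ k)
  pointwise k with T k | χ k
  ... | true  | true  = refl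
  ... | true  | false = refl
  ... | false | true  = refl
  ... | false | false = refl

signedSum-not : ∀ {n} (T : EdgeSet n) χ → ℤ→ℚ (signedSum {n} T (not ∘ χ)) ≡ - ℤ→ℚ (signedSum {n} T χ)
signedSum-not {n} T χ = trans (signedSum-wsum {n} T (not ∘ χ)) (trans (sum-cong-≗ pointwise)
  (trans (sum-neg (λ k → 𝟙 (T k) * sign (χ k))) (cong -_ (sym (signedSum-wsum {n} T χ)))))
  where
  pointwise : ∀ k → 𝟙 (T k) * sign (not (χ k)) ≡ - (𝟙 (T k) * sign (χ k))
  pointwise k with T k | χ k
  ... | true  | true  = refl
  ... | true  | false = refl
  ... | false | true  = refl
  ... | false | false = refl

-- Here `f` describes the components of colour true. If there are c of them, the tree has n - c
-- edges of sign +1 and c - 1 of sign -1, which explains `value`.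
record BiasedTree {n} (h χ : Fin (M n) → Bool) : Set where
  field
    T         : EdgeSet n
    f         : Fin n → Fin n
    subgraph  : ∀ k → T k ≡ true → h k ≡ true
    connected : ∀ u v → Reach {n} T u v
    size-T    : size {n} T ≡ n ∸ 1
    f-closed  : ∀ k → h k ≡ true → χ k ≡ true → f (lo k) ≡ f (hi k)
    value     : ℤ→ℚ (signedSum {n} T χ) ≡ 1ℚ + ℕ→ℚ n - (roots f + roots f)

-- Kruskal's algorithm, run on the edges of colour true before the others.
biasedTree : ∀ {m} (h χ : Fin (M (suc m)) → Bool) →
  (∀ (f : Fin (suc m) → Fin (suc m)) → (∀ k → h k ≡ true → f (lo k) ≡ f (hi k)) → ∀ u v → f u ≡ f v) →
  BiasedTree h χ
biasedTree {m} h χ conn = record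
  { T = T₂ ; f = f₁
  ; subgraph  = subgraph
  ; connected = λ u v → reach-trans (reach F₂ u) (subst (λ z → Reach {n} T₂ z v) (sym (const u v)) (reach-sym (reach F₂ v)))
  ; size-T    = ℕ→ℚ-injective size≡
  ; f-closed  = λ k hk χk → X₁.closed (colour⁺ true k hk χk)
  ; value     = trans (signedSum-wsum {n} T₂ χ) value≡ }
  where
  n = suc m
  colour : Bool → List (Fin (M n))
  colour b = filter (λ k → χ k Bool.≟ b) (filter (λ k → h k Bool.≟ true) (allFin (M n)))
  colour⁺ : ∀ b k → h k ≡ true → χ k ≡ b → k ∈ colour b
  colour⁺ b k hk χk = ∈-filter⁺ (λ k → χ k Bool.≟ b) (∈-filter⁺ (λ k → h k Bool.≟ true) (∈-allFin k) hk) χk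
  colour⁻ : ∀ {b k} → k ∈ colour b → h k ≡ true × χ k ≡ b
  colour⁻ {b} k∈ with ∈-filter⁻ (λ k → χ k Bool.≟ b) {xs = filter (λ k → h k Bool.≟ true) (allFin (M n))} k∈
  ... | k∈′ , χk = proj₂ (∈-filter⁻ (λ k → h k Bool.≟ true) {xs = allFin (M n)} k∈′) , χk
  F₀ : Forest {n} (λ _ → false) (λ v → v)
  F₀ = record { idem = λ _ → refl ; reach = λ _ → here ; joined = λ _ () }
  X₁ = extend {n} (colour true) F₀
  module X₁ = Extension X₁
  F₁ = X₁.forest
  f₁ = X₁.f′
  X₂ = extend {n} (colour false) F₁
  module X₂ = Extension X₂
  F₂ = X₂.forest
  T₂ = X₂.T′
  subgraph : ∀ k → T₂ k ≡ true → h k ≡ true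
  subgraph k k∈ with X₂.edges k k∈
  ... | inj₂ k∈₂ = proj₁ (colour⁻ k∈₂)
  ... | inj₁ k∈T₁ with X₁.edges k k∈T₁
  ...   | inj₂ k∈₁ = proj₁ (colour⁻ k∈₁)
  -- Connectivity of `h` is supplied in the form that a map which agrees on the ends of every edge
  -- is constant. Applied to the final root map, it leaves a single tree.
  const : ∀ u v → X₂.f′ u ≡ X₂.f′ v
  const = conn X₂.f′ closed
    where
    closed : ∀ k → h k ≡ true → X₂.f′ (lo k) ≡ X₂.f′ (hi k)
    closed k hk with χ k in χk
    ... | true  = X₂.coarser (X₁.closed (colour⁺ true k hk χk))
    ... | false = X₂.closed (colour⁺ false k hk χk)
  wsum-∅ : ∀ w → wsum {n} (λ _ → false) w ≡ 0ℚ
  wsum-∅ w = trans (sum-cong-≗ (λ k → ℚₚ.*-zeroˡ (w k))) (sum-replicate-zero (M n))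
  roots₀ : roots {n} (λ v → v) ≡ ℕ→ℚ n
  roots₀ = trans (sum-cong-≗ {n} (λ v → cong 𝟙 (≡ᵇ-refl v))) (sum-1 n)
  roots₂ : roots X₂.f′ ≡ 1ℚ
  roots₂ = trans (sum-cong-≗ (λ v → cong (λ z → 𝟙 (≡ᵇ z v)) (const v zero))) (#-singleton′ (X₂.f′ zero))
  cancel : ∀ {a b c : ℚ} → a + c ≡ b + c → a ≡ b
  cancel {a} {b} {c} e = trans (solve 2 (λ a c → a := a :+ c :- c) refl a c) (trans (cong (_- c) e) (solve 2 (λ a c → a :+ c :- c := a) refl b c))
  open ≡-Reasoning
  -- With unit weights the invariant says that edges plus roots equal n in both phases, and one root
  -- is left at the end. Since n is `suc m`, the size is `m`.
  size≡ : ℕ→ℚ (size {n} T₂) ≡ ℕ→ℚ m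
  size≡ = cancel (begin
    ℕ→ℚ (size {n} T₂) + 1ℚ                                       ≡⟨ cong₂ (λ s r → s + 1ℚ * r) (size-wsum {n} T₂) (sym roots₂) ⟩
    wsum {n} T₂ (λ _ → 1ℚ) + 1ℚ * roots X₂.f′                    ≡⟨ X₂.balance (λ _ → 1ℚ) 1ℚ (λ _ → refl) ⟩
    wsum {n} X₁.T′ (λ _ → 1ℚ) + 1ℚ * roots f₁                    ≡⟨ X₁.balance (λ _ → 1ℚ) 1ℚ (λ _ → refl) ⟩
    wsum {n} (λ _ → false) (λ _ → 1ℚ) + 1ℚ * roots {n} (λ v → v) ≡⟨ cong₂ (λ s r → s + 1ℚ * r) (wsum-∅ (λ _ → 1ℚ)) roots₀ ⟩
    0ℚ + 1ℚ * ℕ→ℚ n                                              ≡⟨ solve 1 (λ n → con 0ℚ :+ con 1ℚ :* n := n) refl (ℕ→ℚ n) ⟩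
    ℕ→ℚ (1 ℕ.+ m)                                                ≡⟨ ℕ→ℚ-+ 1 m ⟩
    1ℚ + ℕ→ℚ m                                                   ≡⟨ ℚₚ.+-comm 1ℚ (ℕ→ℚ m) ⟩
    ℕ→ℚ m + 1ℚ                                                   ∎)
  wt : Fin (M n) → ℚ
  wt = sign ∘ χ
  -- The first phase only accepts edges of sign +1, so the balance holds with constant 1; the second
  -- only accepts edges of sign -1 and uses the constant -1.
  value₁ : wsum {n} X₁.T′ wt + 1ℚ * roots f₁ ≡ 0ℚ + 1ℚ * ℕ→ℚ n
  value₁ = trans (X₁.balance wt 1ℚ (λ k∈ → cong sign (proj₂ (colour⁻ {true} k∈)))) (cong₂ (λ s r → s + 1ℚ * r) (wsum-∅ wt) roots₀)
  value₂ : wsum {n} T₂ wt + (- 1ℚ) * 1ℚ ≡ wsum {n} X₁.T′ wt + (- 1ℚ) * roots f₁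
  value₂ = trans (cong (λ r → wsum {n} T₂ wt + (- 1ℚ) * r) (sym roots₂)) (X₂.balance wt (- 1ℚ) (λ k∈ → cong sign (proj₂ (colour⁻ {false} k∈))))
  value≡ : wsum {n} T₂ wt ≡ 1ℚ + ℕ→ℚ n - (roots f₁ + roots f₁)
  value≡ = cancel (begin
    wsum {n} T₂ wt + (- 1ℚ) * 1ℚ                      ≡⟨ value₂ ⟩
    wsum {n} X₁.T′ wt + (- 1ℚ) * roots f₁             ≡⟨ solve 2 (λ s r → s :+ (:- con 1ℚ) :* r := s :+ con 1ℚ :* r :- (r :+ r)) refl (wsum {n} X₁.T′ wt) (roots f₁) ⟩
    wsum {n} X₁.T′ wt + 1ℚ * roots f₁ - (roots f₁ + roots f₁)  ≡⟨ cong (_- (roots f₁ + roots f₁)) value₁ ⟩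
    0ℚ + 1ℚ * ℕ→ℚ n - (roots f₁ + roots f₁)           ≡⟨ solve 2 (λ n r → con 0ℚ :+ con 1ℚ :* n :- r := con 1ℚ :+ n :- r :+ (:- con 1ℚ) :* con 1ℚ) refl (ℕ→ℚ n) (roots f₁ + roots f₁) ⟩
    1ℚ + ℕ→ℚ n - (roots f₁ + roots f₁) + (- 1ℚ) * 1ℚ  ∎)

-- Counting edge slots

sum-lookup : ∀ {A : Set} (ψ : A → ℚ) xs → sum (λ k → ψ (lookup xs k)) ≡ lsum ψ xs
sum-lookup ψ []       = refl
sum-lookup ψ (x ∷ xs) = cong (ψ x +_) (sum-lookup ψ xs)

lsum-filter : ∀ {A : Set} (q : A → Bool) (ψ : A → ℚ) xs → lsum ψ (filterᵇ q xs) ≡ lsum (λ x → 𝟙 (q x) * ψ x) xs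
lsum-filter q ψ [] = refl
lsum-filter q ψ (x ∷ xs) with q x
... | true  = cong₂ _+_ (sym (ℚₚ.*-identityˡ (ψ x))) (lsum-filter q ψ xs)
... | false = trans (lsum-filter q ψ xs) (trans (sym (ℚₚ.+-identityˡ _)) (cong (_+ _) (sym (ℚₚ.*-zeroˡ (ψ x)))))

lsum-map : ∀ {A B : Set} (g : A → B) (ψ : B → ℚ) xs → lsum ψ (map g xs) ≡ lsum (ψ ∘ g) xs
lsum-map g ψ []       = refl
lsum-map g ψ (x ∷ xs) = cong (ψ (g x) +_) (lsum-map g ψ xs)

lsum-cartesianProduct : ∀ {A B : Set} (ψ : A × B → ℚ) xs ys →
  lsum ψ (cartesianProduct xs ys) ≡ lsum (λ x → lsum (λ y → ψ (x , y)) ys) xs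
lsum-cartesianProduct ψ []       ys = refl
lsum-cartesianProduct ψ (x ∷ xs) ys = trans (lsum-++ ψ (map (x ,_) ys) (cartesianProduct xs ys))
  (cong₂ _+_ (lsum-map (x ,_) ψ ys) (lsum-cartesianProduct ψ xs ys))

lsum-allFin : ∀ {n} (f : Fin n → ℚ) → lsum f (allFin n) ≡ sum f
lsum-allFin f = foldr-allFin _+_ 0ℚ (λ x → x) (λ _ _ → refl) refl f

lt : ∀ {n} → Fin n → Fin n → ℚ
lt i j = 𝟙 (toℕ i <ᵇ toℕ j)

sum-slots : ∀ n (ψ : Fin n → Fin n → ℚ) →
  sum (λ k → ψ (lo k) (hi k)) ≡ sum (λ i → sum (λ j → lt i j * ψ i j))
sum-slots n ψ = trans (sum-lookup (λ (i , j) → ψ i j) (pairs n))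
  (trans (lsum-filter _ (λ (i , j) → ψ i j) (cartesianProduct (allFin n) (allFin n)))
  (trans (lsum-cartesianProduct _ (allFin n) (allFin n))
  (trans (lsum-allFin (λ i → lsum (λ j → lt i j * ψ i j) (allFin n)))
  (sum-cong-≗ (λ i → lsum-allFin (λ j → lt i j * ψ i j))))))

-- Counting each slot in both orientations gives a sum over ordered pairs in which the factor
-- `lt i j + lt j i` removes just the diagonal.
sum-slots-sym : ∀ n (φ : Fin n → Fin n → ℚ) →
  sum (λ k → φ (lo k) (hi k) + φ (hi k) (lo k)) ≡ sum (λ i → sum (λ j → (lt i j + lt j i) * φ i j))
sum-slots-sym n φ = begin
  sum (λ k → φ (lo k) (hi k) + φ (hi k) (lo k))
    ≡⟨ ∑-distrib-+ (λ k → φ (lo k) (hi k)) (λ k → φ (hi k) (lo k)) ⟩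
  sum (λ k → φ (lo k) (hi k)) + sum (λ k → φ (hi k) (lo k))
    ≡⟨ cong₂ _+_ (sum-slots n φ) (trans (sum-slots n (λ i j → φ j i)) (∑-comm (λ i j → lt i j * φ j i))) ⟩
  sum (λ i → sum (λ j → lt i j * φ i j)) + sum (λ i → sum (λ j → lt j i * φ i j))
    ≡⟨ ∑-distrib-+ (λ i → sum (λ j → lt i j * φ i j)) (λ i → sum (λ j → lt j i * φ i j)) ⟨
  sum (λ i → sum (λ j → lt i j * φ i j) + sum (λ j → lt j i * φ i j))
    ≡⟨ sum-cong-≗ (λ i → trans (sym (∑-distrib-+ (λ j → lt i j * φ i j) (λ j → lt j i * φ i j)))
         (sum-cong-≗ (λ j → sym (ℚₚ.*-distribʳ-+ (φ i j) (lt i j) (lt j i))))) ⟩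
  sum (λ i → sum (λ j → (lt i j + lt j i) * φ i j)) ∎
  where open ≡-Reasoning

<ᵇ-true : ∀ {m n} → m ℕ.< n → (m <ᵇ n) ≡ true
<ᵇ-true m<n = Equivalence.to Boolₚ.T-≡ (ℕₚ.<⇒<ᵇ m<n)

<ᵇ-false : ∀ {m n} → ¬ m ℕ.< n → (m <ᵇ n) ≡ false
<ᵇ-false {m} {n} m≮n with m <ᵇ n in eq
... | true  = ⊥-elim (m≮n (ℕₚ.<ᵇ⇒< m n (Equivalence.from Boolₚ.T-≡ eq)))
... | false = refl

lt+gt : ∀ {n} (i j : Fin n) → lt i j + lt j i ≡ 1ℚ - 𝟙 (≡ᵇ i j)
lt+gt i j with ℕₚ.<-cmp (toℕ i) (toℕ j)
... | tri< l i≢j g rewrite <ᵇ-true l | <ᵇ-false g | ≡ᵇ-false {u = i} {j} (i≢j ∘ cong toℕ) = refl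
... | tri> l i≢j g rewrite <ᵇ-false l | <ᵇ-true g | ≡ᵇ-false {u = i} {j} (i≢j ∘ cong toℕ) = refl
... | tri≈ l i≡j g rewrite Finₚ.toℕ-injective i≡j | <ᵇ-false (ℕₚ.<-irrefl {toℕ j} refl) | ≡ᵇ-refl j = refl

lt+gt≤1 : ∀ {n} (i j : Fin n) → lt i j + lt j i ≤ 1ℚ
lt+gt≤1 i j = 0≤⇒≤ (0≤𝟙 (≡ᵇ i j)) (trans (cong (λ z → 1ℚ - z) (lt+gt i j)) (solve 1 (λ x → con 1ℚ :- (con 1ℚ :- x) := x) refl (𝟙 (≡ᵇ i j))))

slot : ∀ {n} {u v : Fin n} → ¬ u ≡ v → ∃ λ k → lookup (pairs n) k ≡ (u , v) ⊎ lookup (pairs n) k ≡ (v , u)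
slot {n} {u} {v} u≢v with ℕₚ.<-cmp (toℕ u) (toℕ v)
... | tri≈ _ u≡v _ = ⊥-elim (u≢v (Finₚ.toℕ-injective u≡v))
... | tri< u<v _ _ = index p , inj₁ (sym (lookup-index p))
  where
  p : (u , v) ∈ pairs n
  p = ∈-filter⁺ (T? ∘ _) (∈-cartesianProduct⁺ (∈-allFin u) (∈-allFin v)) (ℕₚ.<⇒<ᵇ u<v)
... | tri> _ _ v<u = index p , inj₂ (sym (lookup-index p))
  where
  p : (v , u) ∈ pairs n
  p = ∈-filter⁺ (T? ∘ _) (∈-cartesianProduct⁺ (∈-allFin v) (∈-allFin u)) (ℕₚ.<⇒<ᵇ v<u)

M≤n² : ∀ n → ℕ→ℚ (M n) ≤ ℕ→ℚ n * ℕ→ℚ n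
M≤n² n = begin
  ℕ→ℚ (M n)                                ≡⟨ sum-1 (M n) ⟨
  sum {M n} (λ _ → 1ℚ)                     ≡⟨ sum-slots n (λ _ _ → 1ℚ) ⟩
  sum {n} (λ i → sum {n} (λ j → lt i j * 1ℚ))  ≤⟨ sum-mono {n} (λ i → sum-mono {n} (λ j → ℚₚ.≤-trans (ℚₚ.≤-reflexive (ℚₚ.*-identityʳ (lt i j))) (𝟙≤1 (toℕ i <ᵇ toℕ j)))) ⟩
  sum {n} (λ i → sum {n} (λ j → 1ℚ))       ≡⟨ sum-cong-≗ {n} (λ i → sum-1 n) ⟩
  sum {n} (λ i → ℕ→ℚ n)                    ≡⟨ sum-const n (ℕ→ℚ n) ⟩
  ℕ→ℚ n * ℕ→ℚ n                            ∎
  where open ℚₚ.≤-Reasoning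

degree-# : ∀ {n} (G : Graph n) v → ℕ→ℚ (degree G v) ≡ # (adj G v)
degree-# {n} G v = trans (foldr-allFin ℕ._+_ 0 ℕ→ℚ ℕ→ℚ-+ refl (λ u → if adj G v u then 1 else 0)) (sum-cong-≗ pointwise)
  where
  pointwise : ∀ u → ℕ→ℚ (if adj G v u then 1 else 0) ≡ 𝟙 (adj G v u)
  pointwise u with adj G v u
  ... | true  = refl
  ... | false = refl

sum-product : ∀ {m n} (f : Fin m → ℚ) (g : Fin n → ℚ) → sum (λ i → sum (λ j → f i * g j)) ≡ sum f * sum g
sum-product f g = trans (sum-cong-≗ (λ i → sym (*-distribˡ-sum (f i) g))) (sym (*-distribʳ-sum (sum g) f))

-- The coefficient of a slot in the number of edges between the neighbourhoods of v and w.
between : ∀ {n} → Graph n → Fin n → Fin n → Fin (M n) → ℚ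
between G v w k = 𝟙 (adj G v (lo k)) * 𝟙 (adj G w (hi k)) + 𝟙 (adj G v (hi k)) * 𝟙 (adj G w (lo k))

incident : ∀ {n} → Fin n → Fin (M n) → ℚ
incident v k = 𝟙 (≡ᵇ (lo k) v ∨ ≡ᵇ (hi k) v)

-- The coefficients add up to the number of pairs in the product of the two neighbourhoods with
-- distinct entries; discarding the diagonal costs at most n.
sum-between : ∀ {n} (G : Graph n) v w → # (adj G v) * # (adj G w) - ℕ→ℚ n ≤ sum (between G v w)
sum-between {n} G v w = begin
  # (adj G v) * # (adj G w) - ℕ→ℚ n
    ≡⟨ cong₂ _-_ (sym (sum-product (𝟙 ∘ adj G v) (𝟙 ∘ adj G w))) (trans (sym (sum-1 n)) (sum-cong-≗ {n} (λ i → sym (#-singleton′ i)))) ⟩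
  sum (λ i → sum (φ i)) - sum {n} (λ i → # (≡ᵇ i))
    ≡⟨ trans (sym (sum-- (λ i → sum (φ i)) (λ i → # (≡ᵇ i)))) (sum-cong-≗ (λ i → sym (sum-- (φ i) (λ j → 𝟙 (≡ᵇ i j))))) ⟩
  sum (λ i → sum (λ j → φ i j - 𝟙 (≡ᵇ i j)))
    ≤⟨ sum-mono (λ i → sum-mono (pointwise i)) ⟩
  sum (λ i → sum (λ j → (lt i j + lt j i) * φ i j))
    ≡⟨ sum-slots-sym n φ ⟨
  sum (between G v w) ∎
  where
  open ℚₚ.≤-Reasoning
  φ : Fin n → Fin n → ℚ
  φ i j = 𝟙 (adj G v i) * 𝟙 (adj G w j)
  φ≤1 : ∀ i j → φ i j ≤ 1ℚ
  φ≤1 i j = *-mono (0≤𝟙 (adj G v i)) (0≤𝟙 (adj G w j)) (𝟙≤1 (adj G v i)) (𝟙≤1 (adj G w j))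
  pointwise : ∀ i j → φ i j - 𝟙 (≡ᵇ i j) ≤ (lt i j + lt j i) * φ i j
  pointwise i j = 0≤⇒≤ (0≤𝟙 (≡ᵇ i j) ⊛ ≤⇒0≤ (φ≤1 i j)) (trans (cong (λ z → z * φ i j - (φ i j - 𝟙 (≡ᵇ i j))) (lt+gt i j))
    (solve 2 (λ e x → (con 1ℚ :- e) :* x :- (x :- e) := e :* (con 1ℚ :- x)) refl (𝟙 (≡ᵇ i j)) (φ i j)))

between² : ∀ {n} (G : Graph n) v w k → between G v w k * between G v w k ≤ ℕ→ℚ 4
between² G v w k = *-mono 0≤b 0≤b b≤2 b≤2
  where
  0≤𝟙𝟙 : ∀ a b → 0ℚ ≤ 𝟙 a * 𝟙 b
  0≤𝟙𝟙 a b = 0≤𝟙 a ⊛ 0≤𝟙 b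
  𝟙𝟙≤1 : ∀ a b → 𝟙 a * 𝟙 b ≤ 1ℚ
  𝟙𝟙≤1 a b = *-mono (0≤𝟙 a) (0≤𝟙 b) (𝟙≤1 a) (𝟙≤1 b)
  0≤b : 0ℚ ≤ between G v w k
  0≤b = 0≤𝟙𝟙 (adj G v (lo k)) (adj G w (hi k)) ⊕ 0≤𝟙𝟙 (adj G v (hi k)) (adj G w (lo k))
  b≤2 : between G v w k ≤ 1ℚ + 1ℚ
  b≤2 = ℚₚ.+-mono-≤ (𝟙𝟙≤1 (adj G v (lo k)) (adj G w (hi k))) (𝟙𝟙≤1 (adj G v (hi k)) (adj G w (lo k)))

sum-incident : ∀ {n} (v : Fin n) → sum (incident v) ≤ ℕ→ℚ n
sum-incident {n} v = begin
  sum (incident v)                                            ≤⟨ sum-mono (λ k → ∨≤+ (≡ᵇ (lo k) v) (≡ᵇ (hi k) v)) ⟩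
  sum {M n} (λ k → 𝟙 (≡ᵇ (lo k) v) + 𝟙 (≡ᵇ (hi k) v))         ≡⟨ sum-slots-sym n (λ i j → 𝟙 (≡ᵇ i v)) ⟩
  sum {n} (λ i → sum {n} (λ j → (lt i j + lt j i) * 𝟙 (≡ᵇ i v)))      ≤⟨ sum-mono (λ i → sum-mono (λ j → *-monoʳ (0≤𝟙 (≡ᵇ i v)) (lt+gt≤1 i j))) ⟩
  sum {n} (λ i → sum {n} (λ j → 1ℚ * 𝟙 (≡ᵇ i v)))                     ≡⟨ ∑-comm {n} {n} (λ i j → 1ℚ * 𝟙 (≡ᵇ i v)) ⟩
  sum {n} (λ j → sum {n} (λ i → 1ℚ * 𝟙 (≡ᵇ i v)))                     ≡⟨ sum-cong-≗ {n} (λ j → trans (sum-cong-≗ (λ i → ℚₚ.*-identityˡ (𝟙 (≡ᵇ i v)))) (#-singleton v)) ⟩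
  sum {n} (λ j → 1ℚ)                                          ≡⟨ sum-1 n ⟩
  ℕ→ℚ n                                                       ∎
  where
  open ℚₚ.≤-Reasoning
  ∨≤+ : ∀ a b → 𝟙 (a ∨ b) ≤ 𝟙 a + 𝟙 b
  ∨≤+ true  true  = ℕ→ℚ-mono {1} {2} (ℕ.s≤s ℕ.z≤n)
  ∨≤+ true  false = ℚₚ.≤-refl
  ∨≤+ false true  = ℚₚ.≤-refl
  ∨≤+ false false = ℚₚ.≤-refl

-- Moments of the random edge counts

deviation² : ∀ {n} → Graph n → ℚ → Fin n → Fin n → Outcome n → ℚ
deviation² G p v w ω = (lin (between G v w) ω - p * sum (between G v w)) * (lin (between G v w) ω - p * sum (between G v w))

-- The number of ordered pairs of distinct random edges at v.
cherries : ∀ {n} → Fin n → Outcome n → ℚ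
cherries {n} v ω = lin (incident {n} v) ω * lin (incident {n} v) ω - lin (incident {n} v) ω

-- The variance is at most `p` times the sum of the squared coefficients; each coefficient is at
-- most 2 and there are at most n² slots.
E-deviation² : ∀ {n} (G : Graph n) {p} → 0ℚ ≤ p → p ≤ 1ℚ → ∀ v w → E p (deviation² G p v w) ≤ ℕ→ℚ 4 * (p * (ℕ→ℚ n * ℕ→ℚ n))
E-deviation² {n} G {p} 0≤p p≤1 v w = begin
  E p (deviation² G p v w)                 ≡⟨ variance-lin p c ⟩
  p * (1ℚ - p) * sum (λ k → c k * c k)     ≤⟨ *-mono (0≤p ⊛ ≤⇒0≤ p≤1) (0≤sum (λ k → 0≤square (c k))) pq≤p Σc²≤ ⟩
  p * (ℕ→ℚ n * ℕ→ℚ n * ℕ→ℚ 4)              ≡⟨ solve 3 (λ p a f → p :* (a :* f) := f :* (p :* a)) refl p (ℕ→ℚ n * ℕ→ℚ n) (ℕ→ℚ 4) ⟩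
  ℕ→ℚ 4 * (p * (ℕ→ℚ n * ℕ→ℚ n))            ∎
  where
  open ℚₚ.≤-Reasoning
  c = between G v w
  pq≤p : p * (1ℚ - p) ≤ p
  pq≤p = 0≤⇒≤ (0≤square p) (solve 1 (λ p → p :- p :* (con 1ℚ :- p) := p :* p) refl p)
  Σc²≤ : sum (λ k → c k * c k) ≤ ℕ→ℚ n * ℕ→ℚ n * ℕ→ℚ 4
  Σc²≤ = ℚₚ.≤-trans (sum-mono (between² G v w)) (ℚₚ.≤-trans (ℚₚ.≤-reflexive (sum-const (M n) (ℕ→ℚ 4))) (*-monoʳ (0≤ℕ→ℚ 4) (M≤n² n)))

-- For 0/1 coefficients with sum `S` the mean cancels the diagonal part of the second moment up to
-- -p²S. What remains is at most (pS)², and a vertex meets at most n slots.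
E-cherries : ∀ {n} {p} → 0ℚ ≤ p → ∀ v → E p (cherries {n} v) ≤ p * ℕ→ℚ n * (p * ℕ→ℚ n)
E-cherries {n} {p} 0≤p v = begin
  E p (cherries {n} v)
    ≡⟨ E-cong p (λ ω → solve 1 (λ l → l :* l :- l := (con 0ℚ :+ (:- con 1ℚ) :* l) :+ l :* l) refl (lin a ω)) ⟩
  E p (λ ω → (0ℚ + (- 1ℚ) * lin a ω) + lin a ω * lin a ω)
    ≡⟨ E-affine p 0ℚ (- 1ℚ) (lin a) (λ ω → lin a ω * lin a ω) ⟩
  (0ℚ + (- 1ℚ) * E p (lin a)) + E p (λ ω → lin a ω * lin a ω)
    ≡⟨ cong₂ (λ x y → (0ℚ + (- 1ℚ) * x) + y) (E-lin p a) (trans (E-lin² p a) (cong (λ s → p * S * (p * S) + p * (1ℚ - p) * s) (sum-cong-≗ a²≡a))) ⟩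
  (0ℚ + (- 1ℚ) * (p * S)) + (p * S * (p * S) + p * (1ℚ - p) * S)
    ≤⟨ 0≤⇒≤ (0≤square p ⊛ 0≤S) (solve 2 (λ p s → p :* s :* (p :* s) :- ((con 0ℚ :+ (:- con 1ℚ) :* (p :* s)) :+ (p :* s :* (p :* s) :+ p :* (con 1ℚ :- p) :* s)) := p :* p :* s) refl p S) ⟩
  p * S * (p * S)
    ≤⟨ *-mono (0≤p ⊛ 0≤S) (0≤p ⊛ 0≤S) (*-monoˡ 0≤p (sum-incident v)) (*-monoˡ 0≤p (sum-incident v)) ⟩
  p * ℕ→ℚ n * (p * ℕ→ℚ n) ∎
  where
  open ℚₚ.≤-Reasoning
  a = incident {n} v
  S = sum a
  0≤S : 0ℚ ≤ S
  0≤S = 0≤sum {f = a} (λ k → 0≤𝟙 (≡ᵇ (lo k) v ∨ ≡ᵇ (hi k) v))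
  a²≡a : ∀ k → a k * a k ≡ a k
  a²≡a k with ≡ᵇ (lo k) v ∨ ≡ᵇ (hi k) v
  ... | true  = refl
  ... | false = refl

-- A substitute for integrality of a rational-valued count: l² - l is negative only for l strictly
-- between 0 and 1, which is what `0≤cherries` has to exclude.
ZeroOr≥1 : ℚ → Set
ZeroOr≥1 x = x ≡ 0ℚ ⊎ 1ℚ ≤ x

sum-ZeroOr≥1 : ∀ {n} (f : Fin n → ℚ) → (∀ i → ZeroOr≥1 (f i)) → ZeroOr≥1 (sum f)
sum-ZeroOr≥1 {zero}  f h = inj₁ refl
sum-ZeroOr≥1 {suc n} f h with h zero | sum-ZeroOr≥1 (f ∘ suc) (h ∘ suc)
... | inj₁ e | inj₁ e′ = inj₁ (cong₂ _+_ e e′)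
... | inj₁ e | inj₂ l  = inj₂ (ℚₚ.+-mono-≤ (ℚₚ.≤-reflexive (sym e)) l)
... | inj₂ l | inj₁ e′ = inj₂ (ℚₚ.+-mono-≤ l (ℚₚ.≤-reflexive (sym e′)))
... | inj₂ l | inj₂ l′ = inj₂ (ℚₚ.+-mono-≤ l (ℚₚ.≤-trans (0≤𝟙 true) l′))

0≤cherries : ∀ {n} (v : Fin n) ω → 0ℚ ≤ cherries {n} v ω
0≤cherries {n} v ω with sum-ZeroOr≥1 (λ k → incident {n} v k * 𝟙 (Vec.lookup ω k)) (λ k → cases (≡ᵇ (lo k) v ∨ ≡ᵇ (hi k) v) (Vec.lookup ω k))
  where
  cases : ∀ a b → ZeroOr≥1 (𝟙 a * 𝟙 b)
  cases true  true  = inj₂ ℚₚ.≤-refl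
  cases true  false = inj₁ refl
  cases false true  = inj₁ refl
  cases false false = inj₁ refl
... | inj₁ e = ℚₚ.≤-reflexive (sym (cong (λ l → l * l - l) e))
... | inj₂ 1≤l = ℚₚ.≤-trans (ℚₚ.≤-trans (0≤𝟙 true) 1≤l ⊛ ≤⇒0≤ 1≤l)
  (ℚₚ.≤-reflexive (solve 1 (λ l → l :* (l :- con 1ℚ) := l :* l :- l) refl (lin (incident {n} v) ω)))

-- Separations of the perturbed graph

¼ : ℚ
¼ = ℤ.+ 1 / 4

0≤¼ : 0ℚ ≤ ¼
0≤¼ = ℚₚ.nonNegative⁻¹ ¼

0≤½ : 0ℚ ≤ ½
0≤½ = ℚₚ.nonNegative⁻¹ ½

true≢false : ∀ {b} → b ≡ true → b ≡ false → ⊥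
true≢false refl ()

does-true : ∀ {P : Set} (d : Dec P) → does d ≡ true → P
does-true (yes p) _ = p

module _ {n} (G : Graph n) (ω : Outcome n) where

  -- Edges of `G` occur in `H` only as slots with an orientation of their own, so a relation checked
  -- on slots in both directions transfers to adjacency in `G`.
  adj-slots : (R : Fin n → Fin n → Set) → (∀ k → HEdge G ω k ≡ true → R (lo k) (hi k) × R (hi k) (lo k)) →
    ∀ {u v} → adj G u v ≡ true → R u v
  adj-slots R h {u} {v} uv with slot {u = u} {v} (λ u≡v → true≢false (trans (cong (adj G u) u≡v) uv) (irrefl G u))
  ... | k , inj₁ e = subst (λ (i , j) → R i j) e (proj₁ (h k (cong (_∨ Vec.lookup ω k) (trans (cong (λ (i , j) → adj G i j) e) uv))))
  ... | k , inj₂ e = subst (λ (i , j) → R j i) e (proj₂ (h k (cong (_∨ Vec.lookup ω k) (trans (cong (λ (i , j) → adj G i j) e) (trans (adj-sym G v u) uv)))))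

  Separated : (A B : Fin n → Bool) → Set
  Separated A B = ∀ k → HEdge G ω k ≡ true → Apart (lo k) (hi k) × Apart (hi k) (lo k)
    where
    Apart : Fin n → Fin n → Set
    Apart u v = B u ≡ false → A v ≡ false → ⊥

  module _ {A B : Fin n → Bool} (sep : Separated A B) where

    private
      S : Fin n → Bool
      S v = A v ∧ B v
      d : Fin n → ℚ
      d s = lin (incident {n} s) ω
      apart : ∀ {u v} → adj G u v ≡ true → B u ≡ false → A v ≡ false → ⊥
      apart = adj-slots (λ u v → B u ≡ false → A v ≡ false → ⊥) sep

    -- Since `v` is outside `B`, its neighbour `i` lies in `A`; likewise `j` lies in `B`. If neither
    -- were in the overlap, the edge from `i` to `j` would join the two complements.
    touches : ∀ {v w i j} → B v ≡ false → A w ≡ false → (B i ≡ false → A j ≡ false → ⊥) →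
      adj G v i ≡ true → adj G w j ≡ true → S i ≡ true ⊎ S j ≡ true
    touches {v} {w} {i} {j} v∉B w∉A ij vi wj with A i in Ai | B i in Bi | A j in Aj | B j in Bj
    ... | true  | true  | _     | _     = inj₁ refl
    ... | _     | _     | true  | true  = inj₂ refl
    ... | false | _     | _     | _     = ⊥-elim (apart vi v∉B Ai)
    ... | _     | _     | _     | false = ⊥-elim (apart (trans (adj-sym G j w) wj) Bj w∉A)
    ... | true  | false | false | true  = ⊥-elim (ij refl refl)

    -- The number of ends of a slot in the overlap, written as a sum over vertices so that
    -- exchanging the sums in `sum-hits` produces the random degrees of the overlap vertices.
    hits : Fin (M n) → ℚ
    hits k = sum (λ s → 𝟙 (S s) * incident {n} s k)

    0≤hits : ∀ k → 0ℚ ≤ hits k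
    0≤hits k = 0≤sum {f = λ s → 𝟙 (S s) * incident {n} s k} (λ s → 0≤𝟙 (S s) ⊛ 0≤𝟙 (≡ᵇ (lo k) s ∨ ≡ᵇ (hi k) s))

    1≤hits : ∀ k → S (lo k) ≡ true ⊎ S (hi k) ≡ true → 1ℚ ≤ hits k
    1≤hits k c = ℚₚ.≤-trans (ℚₚ.≤-reflexive (sym (proj₂ (at c))))
      (term≤sum {f = λ s → 𝟙 (S s) * incident {n} s k} (λ s → 0≤𝟙 (S s) ⊛ 0≤𝟙 (≡ᵇ (lo k) s ∨ ≡ᵇ (hi k) s)) (proj₁ (at c)))
      where
      at : S (lo k) ≡ true ⊎ S (hi k) ≡ true → ∃ λ s → 𝟙 (S s) * incident {n} s k ≡ 1ℚ
      at (inj₁ e) = lo k , cong₂ (λ a b → 𝟙 a * 𝟙 b) e (cong (_∨ ≡ᵇ (hi {n} k) (lo {n} k)) (≡ᵇ-refl (lo {n} k)))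
      at (inj₂ e) = hi k , cong₂ (λ a b → 𝟙 a * 𝟙 b) e (trans (cong (≡ᵇ (lo {n} k) (hi {n} k) ∨_) (≡ᵇ-refl (hi {n} k))) (Boolₚ.∨-zeroʳ _))

    -- Each of the two orientations of a present slot that runs between the neighbourhoods forces an
    -- end in the overlap; hence the factor two.
    between≤hits : ∀ {v w} → B v ≡ false → A w ≡ false → ∀ k →
      between G v w k * 𝟙 (Vec.lookup ω k) ≤ (hits k + hits k) * 𝟙 (Vec.lookup ω k)
    between≤hits {v} {w} v∉B w∉A k with Vec.lookup ω k in ωk
    ... | false = ℚₚ.≤-reflexive (trans (ℚₚ.*-zeroʳ (between G v w k)) (sym (ℚₚ.*-zeroʳ (hits k + hits k))))
    ... | true  = *-monoʳ (0≤𝟙 true) (ℚₚ.+-mono-≤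
      (bound (adj G v (lo k)) (adj G w (hi k)) (λ vi wj → touches v∉B w∉A (proj₁ (sep k hk)) vi wj))
      (bound (adj G v (hi k)) (adj G w (lo k)) (λ vi wj → Sum.swap (touches v∉B w∉A (proj₂ (sep k hk)) vi wj))))
      where
      hk : HEdge G ω k ≡ true
      hk = trans (cong (adj G (lo k) (hi k) ∨_) ωk) (Boolₚ.∨-zeroʳ _)
      bound : ∀ a b → (a ≡ true → b ≡ true → S (lo k) ≡ true ⊎ S (hi k) ≡ true) → 𝟙 a * 𝟙 b ≤ hits k
      bound true  true  h = 1≤hits k (h refl refl)
      bound true  false h = 0≤hits k
      bound false true  h = 0≤hits k
      bound false false h = 0≤hits k

    sum-hits : sum (λ k → hits k * 𝟙 (Vec.lookup ω k)) ≡ sum (λ s → 𝟙 (S s) * d s)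
    sum-hits = begin
      sum (λ k → hits k * 𝟙 (Vec.lookup ω k))
        ≡⟨ sum-cong-≗ (λ k → *-distribʳ-sum (𝟙 (Vec.lookup ω k)) (λ s → 𝟙 (S s) * incident {n} s k)) ⟩
      sum (λ k → sum (λ s → 𝟙 (S s) * incident {n} s k * 𝟙 (Vec.lookup ω k)))
        ≡⟨ ∑-comm (λ k s → 𝟙 (S s) * incident {n} s k * 𝟙 (Vec.lookup ω k)) ⟩
      sum (λ s → sum (λ k → 𝟙 (S s) * incident {n} s k * 𝟙 (Vec.lookup ω k)))
        ≡⟨ sum-cong-≗ (λ s → trans (sum-cong-≗ (λ k → ℚₚ.*-assoc (𝟙 (S s)) (incident {n} s k) (𝟙 (Vec.lookup ω k))))
             (sym (*-distribˡ-sum (𝟙 (S s)) (λ k → incident {n} s k * 𝟙 (Vec.lookup ω k))))) ⟩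
      sum (λ s → 𝟙 (S s) * d s) ∎
      where open ≡-Reasoning

    -- (d − 1)² ≥ 0 gives d ≤ 1 + d(d − 1).
    degrees≤ : sum (λ s → 𝟙 (S s) * d s) ≤ # S + sum (λ s → cherries {n} s ω)
    degrees≤ = ℚₚ.≤-trans (sum-mono pointwise) (ℚₚ.≤-reflexive (∑-distrib-+ (𝟙 ∘ S) (λ s → cherries {n} s ω)))
      where
      pointwise : ∀ s → 𝟙 (S s) * d s ≤ 𝟙 (S s) + cherries {n} s ω
      pointwise s with S s
      ... | true  = 0≤⇒≤ (0≤square (d s - 1ℚ)) (solve 1 (λ d → (con 1ℚ :+ (d :* d :- d)) :- con 1ℚ :* d := (d :- con 1ℚ) :* (d :- con 1ℚ)) refl (d s))
      ... | false = ℚₚ.≤-trans (ℚₚ.≤-reflexive (ℚₚ.*-zeroˡ (d s))) (ℚₚ.≤-trans (0≤cherries {n} s ω) (ℚₚ.≤-reflexive (sym (ℚₚ.+-identityˡ _))))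

    lin-between≤ : ∀ {v w} → B v ≡ false → A w ≡ false → ∀ {s c} → # S ≤ s → sum (λ s → cherries {n} s ω) ≤ c →
      lin (between G v w) ω ≤ (s + c) + (s + c)
    lin-between≤ {v} {w} v∉B w∉A {s} {c} S≤s C≤c = begin
      lin (between G v w) ω                                       ≤⟨ sum-mono (between≤hits v∉B w∉A) ⟩
      sum (λ k → (hits k + hits k) * 𝟙 (Vec.lookup ω k))           ≡⟨ sum-cong-≗ (λ k → ℚₚ.*-distribʳ-+ (𝟙 (Vec.lookup ω k)) (hits k) (hits k)) ⟩
      sum (λ k → hits k * 𝟙 (Vec.lookup ω k) + hits k * 𝟙 (Vec.lookup ω k)) ≡⟨ ∑-distrib-+ (λ k → hits k * 𝟙 (Vec.lookup ω k)) (λ k → hits k * 𝟙 (Vec.lookup ω k)) ⟩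
      sum (λ k → hits k * 𝟙 (Vec.lookup ω k)) + sum (λ k → hits k * 𝟙 (Vec.lookup ω k)) ≤⟨ ℚₚ.+-mono-≤ half half ⟩
      (s + c) + (s + c)                                            ∎
      where
      open ℚₚ.≤-Reasoning
      half : sum (λ k → hits k * 𝟙 (Vec.lookup ω k)) ≤ s + c
      half = ℚₚ.≤-trans (ℚₚ.≤-reflexive sum-hits) (ℚₚ.≤-trans degrees≤ (ℚₚ.+-mono-≤ S≤s C≤c))

    -- For every pair with `v` outside `B` and `w` outside `A` the edge count is at most `x` while
    -- its mean is at least 2x, so the squared deviation is at least x². There are at least y² such
    -- pairs, and summing over all pairs gives a bound that no longer mentions `A` and `B`.
    separation : ∀ {p x y s c} → 0ℚ ≤ x → 0ℚ ≤ y → (∀ v w → x + x ≤ p * sum (between G v w)) →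
      # S ≤ s → sum (λ v → cherries {n} v ω) ≤ c → (s + c) + (s + c) ≤ x → y ≤ # (not ∘ B) → y ≤ # (not ∘ A) →
      y * y * (x * x) ≤ sum (λ v → sum (λ w → deviation² G p v w ω))
    separation {p} {x} {y} {s} {c} 0≤x 0≤y 2x≤μ S≤s C≤c 2s+2c≤x y≤B y≤A = begin
      y * y * (x * x)                                                       ≤⟨ *-monoʳ (0≤square x) (*-mono 0≤y 0≤y y≤B y≤A) ⟩
      # (not ∘ B) * # (not ∘ A) * (x * x)                                   ≡⟨ cong (_* (x * x)) (sum-product (𝟙 ∘ not ∘ B) (𝟙 ∘ not ∘ A)) ⟨
      sum (λ v → sum (λ w → 𝟙 (not (B v)) * 𝟙 (not (A w)))) * (x * x)
        ≡⟨ trans (*-distribʳ-sum (x * x) (λ v → sum (λ w → 𝟙 (not (B v)) * 𝟙 (not (A w)))))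
             (sum-cong-≗ (λ v → *-distribʳ-sum (x * x) (λ w → 𝟙 (not (B v)) * 𝟙 (not (A w))))) ⟩
      sum (λ v → sum (λ w → 𝟙 (not (B v)) * 𝟙 (not (A w)) * (x * x)))       ≤⟨ sum-mono (λ v → sum-mono (pointwise v)) ⟩
      sum (λ v → sum (λ w → deviation² G p v w ω))                          ∎
      where
      open ℚₚ.≤-Reasoning
      pointwise : ∀ v w → 𝟙 (not (B v)) * 𝟙 (not (A w)) * (x * x) ≤ deviation² G p v w ω
      pointwise v w with B v in v∉B | A w in w∉A
      ... | true  | true  = ℚₚ.≤-trans (ℚₚ.≤-reflexive (ℚₚ.*-zeroˡ (x * x))) (0≤square (lin (between G v w) ω - p * sum (between G v w)))
      ... | true  | false = ℚₚ.≤-trans (ℚₚ.≤-reflexive (ℚₚ.*-zeroˡ (x * x))) (0≤square (lin (between G v w) ω - p * sum (between G v w)))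
      ... | false | true  = ℚₚ.≤-trans (ℚₚ.≤-reflexive (ℚₚ.*-zeroˡ (x * x))) (0≤square (lin (between G v w) ω - p * sum (between G v w)))
      ... | false | false = ℚₚ.≤-trans (ℚₚ.≤-reflexive (ℚₚ.*-identityˡ (x * x))) (ℚₚ.≤-trans (*-mono 0≤x 0≤x x≤ x≤)
          (ℚₚ.≤-reflexive (solve 2 (λ l μ → (μ :- l) :* (μ :- l) := (l :- μ) :* (l :- μ)) refl l μ)))
        where
        l = lin (between G v w) ω
        μ = p * sum (between G v w)
        x≤ : x ≤ μ - l
        x≤ = 0≤⇒≤ (≤⇒0≤ (2x≤μ v w) ⊕ ≤⇒0≤ (ℚₚ.≤-trans (lin-between≤ v∉B w∉A S≤s C≤c) 2s+2c≤x))
          (solve 3 (λ x l μ → μ :- l :- x := (μ :- (x :+ x)) :+ (x :- l)) refl x l μ)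

-- Components

classSize : ∀ {n} → (Fin n → Fin n) → Fin n → ℚ
classSize f v = # (λ u → ≡ᵇ (f u) (f v))

large : ∀ {n} → ℚ → (Fin n → Fin n) → Fin n → Bool
large t f v = does (t ℚₚ.≤? classSize f v)

large-true : ∀ {n} t (f : Fin n → Fin n) v → large t f v ≡ true → t ≤ classSize f v
large-true t f v = does-true (t ℚₚ.≤? classSize f v)

large-false : ∀ {n} t (f : Fin n → Fin n) v → large t f v ≡ false → classSize f v < t
large-false t f v e = ℚₚ.≰⇒> (λ t≤ → true≢false (dec-true (t ℚₚ.≤? classSize f v) t≤) e)

-- Roots of small classes are themselves vertices outside the large classes. The large classes are
-- disjoint and have at least `t` vertices each, so there are at most `K` of them.
roots≤ : ∀ {n} (f : Fin n → Fin n) {t K} → 0ℚ < t → ℕ→ℚ n ≤ t * K → roots f ≤ # (not ∘ large t f) + K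
roots≤ {n} f {t} {K} 0<t n≤tK = begin
  roots f                            ≤⟨ sum-mono (λ x → split (≡ᵇ (f x) x) (large t f x)) ⟩
  sum (λ x → 𝟙 (not (large t f x)) + 𝟙 (R x))  ≡⟨ ∑-distrib-+ (λ x → 𝟙 (not (large t f x))) (𝟙 ∘ R) ⟩
  # (not ∘ large t f) + # R          ≤⟨ ℚₚ.+-monoʳ-≤ (# (not ∘ large t f)) (*-cancel 0<t (ℚₚ.≤-trans tR≤n n≤tK)) ⟩
  # (not ∘ large t f) + K            ∎
  where
  open ℚₚ.≤-Reasoning
  R : Fin n → Bool
  R x = ≡ᵇ (f x) x ∧ large t f x
  split : ∀ a b → 𝟙 a ≤ 𝟙 (not b) + 𝟙 (a ∧ b)
  split true  true  = ℚₚ.≤-refl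
  split true  false = ℚₚ.≤-refl
  split false true  = ℚₚ.≤-refl
  split false false = 0≤𝟙 true
  pointwise : ∀ x → t * 𝟙 (R x) ≤ # (λ u → ≡ᵇ (f u) x)
  pointwise x with R x in eq
  ... | false = ℚₚ.≤-trans (ℚₚ.≤-reflexive (ℚₚ.*-zeroʳ t)) (0≤sum {f = λ u → 𝟙 (≡ᵇ (f u) x)} (λ u → 0≤𝟙 (≡ᵇ (f u) x)))
  ... | true with f x ≟ x
  ...   | yes e = ℚₚ.≤-trans (ℚₚ.≤-reflexive (ℚₚ.*-identityʳ t)) (subst (λ z → t ≤ # (λ u → ≡ᵇ (f u) z)) e (large-true t f x eq))
  tR≤n : t * # R ≤ ℕ→ℚ n
  tR≤n = begin
    t * # R                                        ≡⟨ *-distribˡ-sum t (𝟙 ∘ R) ⟩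
    sum (λ x → t * 𝟙 (R x))                        ≤⟨ sum-mono pointwise ⟩
    sum (λ x → sum (λ u → 𝟙 (≡ᵇ (f u) x)))         ≡⟨ ∑-comm (λ x u → 𝟙 (≡ᵇ (f u) x)) ⟩
    sum (λ u → # (≡ᵇ (f u)))                       ≡⟨ sum-cong-≗ (λ u → #-singleton′ (f u)) ⟩
    sum {n} (λ _ → 1ℚ)                             ≡⟨ sum-1 n ⟩
    ℕ→ℚ n                                          ∎

-- The deterministic half: the outcome is constrained only through `few-cherries` and
-- `concentrated`. `D` is the bias to be reached, `K` bounds the number of large components of one
-- colour, and `x` is at most half of the mean edge count between two neighbourhoods.
module _ {m} (G : Graph (suc m)) (ω : Outcome (suc m)) {α p D K x : ℚ}
  (0<α : 0ℚ < α) (α≤1 : α ≤ 1ℚ) (minDeg : MinDegAtLeast G α)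
  (2≤Kα : 1ℚ + 1ℚ ≤ K * α) (2K≤D : K + K ≤ D) (4D≤n : (D + D) + (D + D) ≤ ℕ→ℚ (suc m))
  (0≤D : 0ℚ ≤ D) (6D≤x : (D + D + D) + (D + D + D) ≤ x)
  (2x≤μ : ∀ v w → x + x ≤ p * sum (between G v w))
  (few-cherries : sum (λ v → cherries {suc m} v ω) ≤ D)
  (concentrated : ¬ (α * ℕ→ℚ (suc m) * ¼) * (α * ℕ→ℚ (suc m) * ¼) * (x * x) ≤ sum (λ v → sum (λ w → deviation² G p v w ω)))
  where

  private
    n = suc m
    N = ℕ→ℚ n
    y = α * N * ¼
    0<N : 0ℚ < N
    0<N = ℚₚ.<-≤-trans (ℚₚ.positive⁻¹ 1ℚ) (ℕ→ℚ-mono {1} {n} (ℕ.s≤s ℕ.z≤n))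
    0≤N = ℚₚ.<⇒≤ 0<N
    0<y : 0ℚ < y
    0<y = 0<* (0<* 0<α 0<N) (ℚₚ.positive⁻¹ ¼)
    0≤y = ℚₚ.<⇒≤ 0<y
    0≤x : 0ℚ ≤ x
    0≤x = ℚₚ.≤-trans ((0≤D ⊕ 0≤D ⊕ 0≤D) ⊕ (0≤D ⊕ 0≤D ⊕ 0≤D)) 6D≤x
    αN≤deg : ∀ v → α * N ≤ # (adj G v)
    αN≤deg v = ℚₚ.≤-trans (minDeg v) (ℚₚ.≤-reflexive (degree-# G v))
    y≤αN : y ≤ α * N
    y≤αN = 0≤⇒≤ (0≤y ⊕ 0≤y ⊕ 0≤y) (solve 1 (λ z → z :- z :* con ¼ := z :* con ¼ :+ z :* con ¼ :+ z :* con ¼) refl (α * N))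

  -- An overlap of at most 2D and a cherry count of at most D allow 2(2D + D) = 6D edges between the
  -- neighbourhoods, and 6D is at most `x`.
  no-separation : ∀ {A B} → Separated G ω A B → # (λ v → A v ∧ B v) ≤ D + D → y ≤ # (not ∘ B) → y ≤ # (not ∘ A) → ⊥
  no-separation {A} {B} sep S≤2D y≤B y≤A = concentrated (separation G ω {A} {B} sep {p} {x} {y} {D + D} {D} 0≤x 0≤y 2x≤μ S≤2D few-cherries 6D≤x y≤B y≤A)

  -- If `f` took two values, the class of `u` and its complement would form a separation with empty
  -- overlap. Both sides are large, since the class of a vertex contains its neighbourhood in `G`.
  connected : (f : Fin n → Fin n) → (∀ k → HEdge G ω k ≡ true → f (lo k) ≡ f (hi k)) → ∀ u v → f u ≡ f v
  connected f closed u v with f u ≟ f v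
  ... | yes e = e
  ... | no fu≢fv = ⊥-elim (no-separation {A} {B} sep S≤2D
      (ℚₚ.≤-trans (class u) (sum-mono λ z → ℚₚ.≤-reflexive (cong 𝟙 (sym (Boolₚ.not-involutive (A z))))))
      (ℚₚ.≤-trans (class v) (sum-mono λ z → other z)))
    where
    A B : Fin n → Bool
    A z = ≡ᵇ (f z) (f u)
    B = not ∘ A
    adj⇒≡ : ∀ {a b} → adj G a b ≡ true → f a ≡ f b
    adj⇒≡ = adj-slots G ω (λ a b → f a ≡ f b) (λ k hk → closed k hk , sym (closed k hk))
    class : ∀ w → y ≤ # (λ z → ≡ᵇ (f z) (f w))
    class w = ℚₚ.≤-trans y≤αN (ℚₚ.≤-trans (αN≤deg w) (sum-mono pointwise))
      where
      pointwise : ∀ z → 𝟙 (adj G w z) ≤ 𝟙 (≡ᵇ (f z) (f w))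
      pointwise z with adj G w z in wz
      ... | false = 0≤𝟙 (≡ᵇ (f z) (f w))
      ... | true  = ℚₚ.≤-reflexive (cong 𝟙 (sym (dec-true (f z ≟ f w) (sym (adj⇒≡ wz)))))
    other : ∀ z → 𝟙 (≡ᵇ (f z) (f v)) ≤ 𝟙 (not (A z))
    other z with f z ≟ f v
    ... | no  _ = 0≤𝟙 (not (A z))
    ... | yes e = ℚₚ.≤-reflexive (cong (𝟙 ∘ not) (sym (≡ᵇ-false (λ e′ → fu≢fv (trans (sym e′) e)))))
    sep : Separated G ω A B
    sep k hk = apart (closed k hk) , apart (sym (closed k hk))
      where
      apart : ∀ {a b} → f a ≡ f b → B a ≡ false → A b ≡ false → ⊥
      apart {a} {b} e Ba Ab = true≢false (cong not (trans (cong (λ z → ≡ᵇ z (f u)) e) Ab)) Ba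
    S≤2D : # (λ z → A z ∧ B z) ≤ D + D
    S≤2D = ℚₚ.≤-trans (ℚₚ.≤-reflexive (trans (sum-cong-≗ (λ z → cong 𝟙 (Boolₚ.∧-inverseʳ (A z)))) (sum-replicate-zero n))) (0≤D ⊕ 0≤D)

  -- The greedy tree is built once for each colour. If both signed sums stay below `D`, then both
  -- colours have many components, and their large components form a forbidden separation.
  good-tree : ∀ χ → ∃ λ (T : EdgeSet n) → SpanningTree G ω T × D ≤ ∣ ℤ→ℚ (signedSum {n} T χ) ∣
  good-tree χ = decide (D ℚₚ.≤? ∣ ℤ→ℚ (signedSum {n} X.T χ) ∣) (D ℚₚ.≤? ∣ ℤ→ℚ (signedSum {n} Y.T (not ∘ χ)) ∣)
    where
    X = biasedTree (HEdge G ω) χ connected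
    Y = biasedTree (HEdge G ω) (not ∘ χ) connected
    module X = BiasedTree X
    module Y = BiasedTree Y
    f = X.f
    g = Y.f
    A B : Fin n → Bool
    A = large (y + y) f
    B = large (y + y) g
    edge : ∀ k → HEdge G ω k ≡ true → f (lo k) ≡ f (hi k) ⊎ g (lo k) ≡ g (hi k)
    edge k hk with χ k in χk
    ... | true  = inj₁ (X.f-closed k hk χk)
    ... | false = inj₂ (Y.f-closed k hk (cong not χk))
    adj⇒ : ∀ {a b} → adj G a b ≡ true → f a ≡ f b ⊎ g a ≡ g b
    adj⇒ = adj-slots G ω (λ a b → f a ≡ f b ⊎ g a ≡ g b) (λ k hk → edge k hk , Sum.map sym sym (edge k hk))
    degree≤ : ∀ v → α * N ≤ classSize f v + classSize g v
    degree≤ v = ℚₚ.≤-trans (αN≤deg v) (ℚₚ.≤-trans (sum-mono pointwise)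
      (ℚₚ.≤-reflexive (∑-distrib-+ (λ u → 𝟙 (≡ᵇ (f u) (f v))) (λ u → 𝟙 (≡ᵇ (g u) (g v))))))
      where
      pointwise : ∀ u → 𝟙 (adj G v u) ≤ 𝟙 (≡ᵇ (f u) (f v)) + 𝟙 (≡ᵇ (g u) (g v))
      pointwise u with adj G v u in vu
      ... | false = 0≤𝟙 (≡ᵇ (f u) (f v)) ⊕ 0≤𝟙 (≡ᵇ (g u) (g v))
      ... | true with adj⇒ vu
      ...   | inj₁ e rewrite dec-true (f u ≟ f v) (sym e) = ℚₚ.+-monoʳ-≤ 1ℚ (0≤𝟙 (≡ᵇ (g u) (g v)))
      ...   | inj₂ e rewrite dec-true (g u ≟ g v) (sym e) = ℚₚ.+-monoˡ-≤ 1ℚ (0≤𝟙 (≡ᵇ (f u) (f v)))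
    -- The neighbours of `v` are split between its two monochromatic components, so one of these has
    -- at least half of the minimum degree, which is the threshold 2y.
    cover : ∀ v → A v ≡ false → B v ≡ false → ⊥
    cover v A∌v B∌v = ℚₚ.<-irrefl refl (ℚₚ.<-≤-trans (ℚₚ.+-mono-< (large-false (y + y) f v A∌v) (large-false (y + y) g v B∌v))
      (ℚₚ.≤-trans (ℚₚ.≤-reflexive (solve 1 (λ z → (z :* con ¼ :+ z :* con ¼) :+ (z :* con ¼ :+ z :* con ¼) := z) refl (α * N))) (degree≤ v)))
    sep : Separated G ω A B
    sep k hk = apart (edge k hk) , apart (Sum.map sym sym (edge k hk))
      where
      apart : ∀ {a b} → f a ≡ f b ⊎ g a ≡ g b → B a ≡ false → A b ≡ false → ⊥
      apart {a} {b} (inj₁ e) Ba Ab = cover a (trans (cong (λ z → does (y + y ℚₚ.≤? # (λ u → ≡ᵇ (f u) z))) e) Ab) Ba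
      apart {a} {b} (inj₂ e) Ba Ab = cover b Ab (trans (cong (λ z → does (y + y ℚₚ.≤? # (λ u → ≡ᵇ (g u) z))) (sym e)) Ba)
    a = # (not ∘ A)
    b = # (not ∘ B)
    s = # (λ v → A v ∧ B v)
    partition : s ≡ N - a - b
    partition = trans (sum-cong-≗ (λ v → pointwise (A v) (B v) (cover v)))
      (trans (sum-- (λ v → 1ℚ - 𝟙 (not (A v))) (λ v → 𝟙 (not (B v))))
      (cong (_- b) (trans (sum-- (λ v → 1ℚ) (λ v → 𝟙 (not (A v)))) (cong (_- a) (sum-1 n)))))
      where
      pointwise : ∀ c d → (c ≡ false → d ≡ false → ⊥) → 𝟙 (c ∧ d) ≡ 1ℚ - 𝟙 (not c) - 𝟙 (not d)
      pointwise true  true  _ = refl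
      pointwise true  false _ = refl
      pointwise false true  _ = refl
      pointwise false false h = ⊥-elim (h refl refl)
    N≤ : N ≤ (y + y) * K
    N≤ = 0≤⇒≤ (0≤½ ⊛ (0≤N ⊛ ≤⇒0≤ 2≤Kα))
      (solve 3 (λ α N K → let y = α :* N :* con ¼ in (y :+ y) :* K :- N := con ½ :* (N :* (K :* α :- (con 1ℚ :+ con 1ℚ)))) refl α N K)
    rf≤ : roots f ≤ a + K
    rf≤ = roots≤ f (ℚₚ.+-mono-< 0<y 0<y) N≤
    rg≤ : roots g ≤ b + K
    rg≤ = roots≤ g (ℚₚ.+-mono-< 0<y 0<y) N≤
    -- The hypotheses give a ≥ (1 + N - D)/2 - K. As 2K ≤ D and 4D ≤ N this is more than N/4, and α
    -- ≤ 1.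
    large-complement : ∀ {r a} → 1ℚ + N - (r + r) ≤ D → r ≤ a + K → y ≤ a
    large-complement {r} {a} v≤D r≤ = 0≤⇒≤
      (≤⇒0≤ r≤ ⊕ 0≤¼ ⊛ (≤⇒0≤ v≤D ⊕ ≤⇒0≤ v≤D ⊕ 0≤𝟙 true ⊕ 0≤𝟙 true ⊕ ≤⇒0≤ 4D≤n ⊕ ≤⇒0≤ 2K≤D ⊕ ≤⇒0≤ 2K≤D ⊕ 0≤N ⊛ ≤⇒0≤ α≤1))
      (solve 6 (λ a r α N K D →
         let v = D :- (con 1ℚ :+ N :- (r :+ r)) in
         a :- α :* N :* con ¼ :=
         (a :+ K :- r) :+ con ¼ :* (v :+ v :+ con 1ℚ :+ con 1ℚ :+ (N :- ((D :+ D) :+ (D :+ D))) :+ (D :- (K :+ K)) :+ (D :- (K :+ K)) :+ N :* (con 1ℚ :- α)))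
       refl a r α N K D)
    -- By `partition` the overlap is N - a - b, at most N + 2K minus the two root counts. These add
    -- up to at least 1 + N - D, which leaves at most D - 1 + 2K.
    small-overlap : 1ℚ + N - (roots f + roots f) ≤ D → 1ℚ + N - (roots g + roots g) ≤ D → s ≤ D + D
    small-overlap vf≤D vg≤D = ℚₚ.≤-trans (ℚₚ.≤-reflexive partition) (0≤⇒≤
      (≤⇒0≤ rf≤ ⊕ ≤⇒0≤ rg≤ ⊕ 0≤½ ⊛ (≤⇒0≤ vf≤D ⊕ ≤⇒0≤ vg≤D) ⊕ 0≤𝟙 true ⊕ ≤⇒0≤ 2K≤D)
      (solve 7 (λ a b r q N K D →
         D :+ D :- (N :- a :- b) :=
         (a :+ K :- r) :+ (b :+ K :- q) :+ con ½ :* ((D :- (con 1ℚ :+ N :- (r :+ r))) :+ (D :- (con 1ℚ :+ N :- (q :+ q)))) :+ con 1ℚ :+ (D :- (K :+ K)))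
       refl a b (roots f) (roots g) N K D))
    decide : _ → _ → _
    decide (yes l) _ = X.T , (X.subgraph , X.connected , X.size-T) , l
    -- The second tree was built for the negated colouring; its signed sum only changes sign under
    -- `χ`, and the absolute value hides this.
    decide (no _) (yes l) = Y.T , (Y.subgraph , Y.connected , Y.size-T) ,
      ℚₚ.≤-trans l (ℚₚ.≤-reflexive (trans (cong ∣_∣ (signedSum-not {n} Y.T χ)) (ℚₚ.∣-p∣≡∣p∣ _)))
    decide (no ¬l) (no ¬l′) = ⊥-elim (no-separation {A} {B} sep (small-overlap vf≤D vg≤D) (large-complement vg≤D rg≤) (large-complement vf≤D rf≤))
      where
      below : ∀ {z c : ℚ} → z ≡ c → ¬ D ≤ ∣ z ∣ → c ≤ D
      below {z} refl ¬l = ℚₚ.≤-trans (a≤∣a∣ z) (ℚₚ.<⇒≤ (ℚₚ.≰⇒> ¬l))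
      vf≤D = below X.value ¬l
      vg≤D = below Y.value ¬l′

-- Constants and the probability of a typical outcome

bias : ℚ → ℚ
-- The mean edge count between two neighbourhoods is at least α²q/2 for large n, so x = α²q/4 is
-- admissible; the factor 1/24 makes 6D equal to `x`.
bias α = α * α * (ℤ.+ 1 / 24)

module _ {m} (G : Graph (suc m)) {α P K ε : ℚ}
  (0<α : 0ℚ < α) (α≤1 : α ≤ 1ℚ) (minDeg : MinDegAtLeast G α) (0≤P : 0ℚ ≤ P) (P≤1 : P ≤ 1ℚ)
  (2≤Kα : 1ℚ + 1ℚ ≤ K * α) (2K≤λq : K + K ≤ bias α * (P * ℕ→ℚ (suc m ℕ.* suc m))) (1≤q : 1ℚ ≤ P * ℕ→ℚ (suc m ℕ.* suc m))
  (2048≤ : ℕ→ℚ 2048 ≤ ε * (α * α * α * α * α * α) * (P * ℕ→ℚ (suc m ℕ.* suc m)))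
  (PN≤ελ : P * ℕ→ℚ (suc m) ≤ ½ * (ε * bias α)) (PN≤1 : P * ℕ→ℚ (suc m) ≤ 1ℚ) (2≤α²N : 1ℚ + 1ℚ ≤ α * α * ℕ→ℚ (suc m))
  where

  private
    n = suc m
    N = ℕ→ℚ n
    q = P * ℕ→ℚ (n ℕ.* n)
    D = bias α * P * ℕ→ℚ (n ℕ.* n)
    x = α * α * q * ¼
    y = α * N * ¼
    t = y * y * (x * x)
    0≤α = ℚₚ.<⇒≤ 0<α
    0≤N = 0≤ℕ→ℚ n
    0<1 : 0ℚ < 1ℚ
    0<1 = ℚₚ.positive⁻¹ 1ℚ
    0<N : 0ℚ < N
    0<N = ℚₚ.<-≤-trans 0<1 (ℕ→ℚ-mono {1} {n} (ℕ.s≤s ℕ.z≤n))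
    0<q = ℚₚ.<-≤-trans 0<1 1≤q
    0≤q = ℚₚ.<⇒≤ 0<q
    0<λ : 0ℚ < bias α
    0<λ = 0<* (0<* 0<α 0<α) (ℚₚ.positive⁻¹ (ℤ.+ 1 / 24))
    D≡λq : D ≡ bias α * q
    D≡λq = ℚₚ.*-assoc (bias α) P _
    q≡PNN : q ≡ P * (N * N)
    q≡PNN = cong (P *_) (ℕ→ℚ-* n n)
    0<D : 0ℚ < D
    0<D = subst (0ℚ <_) (sym D≡λq) (0<* 0<λ 0<q)
    0≤D = ℚₚ.<⇒≤ 0<D
    0<y : 0ℚ < y
    0<y = 0<* (0<* 0<α 0<N) (ℚₚ.positive⁻¹ ¼)
    0<x : 0ℚ < x
    0<x = 0<* (0<* (0<* 0<α 0<α) 0<q) (ℚₚ.positive⁻¹ ¼)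
    0<t : 0ℚ < t
    0<t = 0<* (0<* 0<y 0<y) (0<* 0<x 0<x)
    0≤t = ℚₚ.<⇒≤ 0<t

  6D≤x : (D + D + D) + (D + D + D) ≤ x
  6D≤x = ℚₚ.≤-reflexive (trans (cong (λ d → (d + d + d) + (d + d + d)) D≡λq)
    (solve 2 (λ α q → let d = α :* α :* con (ℤ.+ 1 / 24) :* q in (d :+ d :+ d) :+ (d :+ d :+ d) := α :* α :* q :* con ¼) refl α q))

  4D≤n : (D + D) + (D + D) ≤ N
  4D≤n = ℚₚ.≤-trans (ℚₚ.≤-reflexive (cong (λ d → (d + d) + (d + d)) (trans D≡λq (cong (bias α *_) q≡PNN)))) (0≤⇒≤
    (0≤N ⊛ ≤⇒0≤ (*-mono (0≤α ⊛ 0≤α) (0≤P ⊛ 0≤N) (*-mono 0≤α 0≤α α≤1 α≤1) PN≤1) ⊕ ℚₚ.nonNegative⁻¹ (ℤ.+ 5 / 6) ⊛ (0≤N ⊛ (0≤α ⊛ 0≤α ⊛ (0≤P ⊛ 0≤N))))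
    (solve 3 (λ α P N → let d = α :* α :* con (ℤ.+ 1 / 24) :* (P :* (N :* N)); z = α :* α :* (P :* N) in
       N :- ((d :+ d) :+ (d :+ d)) := N :* (con 1ℚ :* con 1ℚ :* con 1ℚ :- z) :+ con (ℤ.+ 5 / 6) :* (N :* z)) refl α P N))

  -- The diagonal loss n in `sum-between` is at most half of (αn)² because α²n ≥ 2, and the other
  -- half, multiplied by `P`, is 2x.
  2x≤μ : ∀ v w → x + x ≤ P * sum (between G v w)
  2x≤μ v w = ℚₚ.≤-trans (ℚₚ.≤-reflexive (cong (λ q → α * α * q * ¼ + α * α * q * ¼) q≡PNN)) (ℚₚ.≤-trans (0≤⇒≤
    (0≤P ⊛ (≤⇒0≤ (*-mono (0≤α ⊛ 0≤N) (0≤α ⊛ 0≤N) (deg v) (deg w)) ⊕ 0≤½ ⊛ (0≤N ⊛ ≤⇒0≤ 2≤α²N)))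
    (solve 5 (λ α P N a b → let z = α :* α :* (P :* (N :* N)) :* con ¼ in
      P :* (a :* b :- N) :- (z :+ z) := P :* ((a :* b :- α :* N :* (α :* N)) :+ con ½ :* (N :* (α :* α :* N :- (con 1ℚ :+ con 1ℚ)))))
      refl α P N (# (adj G v)) (# (adj G w))))
    (*-monoˡ 0≤P (sum-between G v w)))
    where
    deg : ∀ v → α * N ≤ # (adj G v)
    deg v = ℚₚ.≤-trans (minDeg v) (ℚₚ.≤-reflexive (degree-# G v))

  private
    dev ch W : Outcome n → ℚ
    dev ω = sum (λ v → sum (λ w → deviation² G P v w ω))
    ch ω = sum (λ v → cherries {n} v ω)
    -- One weighted sum handles both bad events: if it is below `t * D`, then `dev` is below `t` and
    -- `ch` is below `D`, so a single use of Markov's inequality suffices.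
    W ω = D * dev ω + t * ch ω
    typical : Outcome n → Bool
    typical ω = does (W ω ℚₚ.<? t * D)
    0≤dev : ∀ ω → 0ℚ ≤ dev ω
    0≤dev ω = 0≤sum (λ v → 0≤sum (λ w → 0≤square (lin (between G v w) ω - P * sum (between G v w))))
    0≤ch : ∀ ω → 0ℚ ≤ ch ω
    0≤ch ω = 0≤sum (λ v → 0≤cherries {n} v ω)

  E-dev : E P dev ≤ N * (N * (ℕ→ℚ 4 * q))
  E-dev = begin
    E P dev                                                  ≡⟨ E-sum P (λ v ω → sum (λ w → deviation² G P v w ω)) ⟩
    sum (λ v → E P (λ ω → sum (λ w → deviation² G P v w ω))) ≡⟨ sum-cong-≗ (λ v → E-sum P (λ w → deviation² G P v w)) ⟩
    sum (λ v → sum (λ w → E P (deviation² G P v w)))         ≤⟨ sum-mono (λ v → sum-mono (λ w → E-deviation² G 0≤P P≤1 v w)) ⟩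
    sum {n} (λ v → sum {n} (λ w → ℕ→ℚ 4 * (P * (N * N))))    ≡⟨ trans (sum-cong-≗ {n} (λ v → sum-const n (ℕ→ℚ 4 * (P * (N * N))))) (sum-const n (N * (ℕ→ℚ 4 * (P * (N * N))))) ⟩
    N * (N * (ℕ→ℚ 4 * (P * (N * N))))                        ≡⟨ cong (λ q → N * (N * (ℕ→ℚ 4 * q))) q≡PNN ⟨
    N * (N * (ℕ→ℚ 4 * q))                                    ∎
    where open ℚₚ.≤-Reasoning

  E-ch : E P ch ≤ P * N * q
  E-ch = begin
    E P ch                                      ≡⟨ E-sum P (λ v → cherries {n} v) ⟩
    sum (λ v → E P (cherries {n} v))            ≤⟨ sum-mono (λ v → E-cherries {n} 0≤P v) ⟩
    sum {n} (λ v → P * N * (P * N))             ≡⟨ sum-const n (P * N * (P * N)) ⟩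
    N * (P * N * (P * N))                       ≡⟨ solve 2 (λ P N → N :* (P :* N :* (P :* N)) := P :* N :* (P :* (N :* N))) refl P N ⟩
    P * N * (P * (N * N))                       ≡⟨ cong (P * N *_) q≡PNN ⟨
    P * N * q                                   ∎
    where open ℚₚ.≤-Reasoning

  -- The failure probability is split evenly: deviations use half of `ε` because p n² is large, and
  -- cherries use the other half because p n is small.
  E-W : E P W ≤ ε * (t * D)
  E-W = begin
    E P W                                                ≡⟨ trans (E-+ P (λ ω → D * dev ω) (λ ω → t * ch ω)) (cong₂ _+_ (E-* P D dev) (E-* P t ch)) ⟩
    D * E P dev + t * E P ch                             ≤⟨ ℚₚ.+-mono-≤ (*-monoˡ 0≤D (ℚₚ.≤-trans E-dev dev≤)) (*-monoˡ 0≤t (ℚₚ.≤-trans E-ch ch≤)) ⟩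
    D * (½ * (ε * t)) + t * (½ * (ε * (bias α * q)))     ≡⟨ cong (λ d → D * (½ * (ε * t)) + t * (½ * (ε * d))) D≡λq ⟨
    D * (½ * (ε * t)) + t * (½ * (ε * D))                ≡⟨ solve 3 (λ D t e → D :* (con ½ :* (e :* t)) :+ t :* (con ½ :* (e :* D)) := e :* (t :* D)) refl D t ε ⟩
    ε * (t * D)                                          ∎
    where
    open ℚₚ.≤-Reasoning
    -- Since t = α⁶N²q²/256, the claim becomes 2048 ≤ εα⁶q after cancelling N²q.
    dev≤ : N * (N * (ℕ→ℚ 4 * q)) ≤ ½ * (ε * t)
    dev≤ = 0≤⇒≤ (ℚₚ.nonNegative⁻¹ (ℤ.+ 1 / 512) ⊛ (0≤N ⊛ (0≤N ⊛ (0≤q ⊛ ≤⇒0≤ 2048≤))))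
      (solve 4 (λ α N q e → let y = α :* N :* con ¼; x = α :* α :* q :* con ¼ in
        con ½ :* (e :* (y :* y :* (x :* x))) :- N :* (N :* (con (ℕ→ℚ 4) :* q)) :=
        con (ℤ.+ 1 / 512) :* (N :* (N :* (q :* (e :* (α :* α :* α :* α :* α :* α) :* q :- con (ℕ→ℚ 2048)))))) refl α N q ε)
    ch≤ : P * N * q ≤ ½ * (ε * (bias α * q))
    ch≤ = ℚₚ.≤-trans (*-monoʳ 0≤q PN≤ελ) (ℚₚ.≤-reflexive (solve 3 (λ e l q → con ½ :* (e :* l) :* q := con ½ :* (e :* (l :* q))) refl ε (bias α) q))

  typical-good : ∀ ω → typical ω ≡ true → Good G (bias α) P ω
  typical-good ω e = good-tree G ω {α} {P} {D} {K} {x} 0<α α≤1 minDeg 2≤Kα (subst (K + K ≤_) (sym D≡λq) 2K≤λq) 4D≤n 0≤D 6D≤x 2x≤μ few-cherries concentrated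
    where
    W< : W ω < t * D
    W< = does-true (W ω ℚₚ.<? t * D) e
    few-cherries : ch ω ≤ D
    few-cherries = *-cancel 0<t (ℚₚ.≤-trans (0≤⇒≤ (0≤D ⊛ 0≤dev ω) (solve 2 (λ a b → a :+ b :- b := a) refl (D * dev ω) (t * ch ω))) (ℚₚ.<⇒≤ W<))
    concentrated : ¬ t ≤ dev ω
    concentrated t≤ = ℚₚ.<-irrefl refl (ℚₚ.<-≤-trans W< (ℚₚ.≤-trans (ℚₚ.≤-trans (ℚₚ.≤-reflexive (ℚₚ.*-comm t D)) (*-monoˡ 0≤D t≤))
      (0≤⇒≤ (0≤t ⊛ 0≤ch ω) (solve 2 (λ a b → a :+ b :- a := b) refl (D * dev ω) (t * ch ω)))))

  good-whp : ProbAtLeast n P (Good G (bias α) P) (1ℚ - ε)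
  good-whp = outcomes typical , outcomes-unique typical , All.map (λ {ω} → typical-good ω) (outcomes-all typical) ,
    ℚₚ.≤-trans (markov 0≤P P≤1 W typical {t * D} {ε} (0<* 0<t 0<D) 0≤W atypical E-W) (ℚₚ.≤-reflexive (sym (weight-outcomes P typical)))
    where
    0≤W : ∀ ω → 0ℚ ≤ W ω
    0≤W ω = 0≤D ⊛ 0≤dev ω ⊕ 0≤t ⊛ 0≤ch ω
    atypical : ∀ ω → typical ω ≡ false → t * D ≤ W ω
    atypical ω e = ℚₚ.≮⇒≥ (λ W< → true≢false (dec-true (W ω ℚₚ.<? t * D) W<) e)

-- Choice of the threshold for n

theorem1p4 : ∀ (α : ℚ) → 0ℚ < α → α < 1ℚ →
    ∃ λ (λ' : ℚ) → 0ℚ < λ' ×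
    (∀ (p : ℕ → ℚ) → PerturbRange p →
    ∀ (ε : ℚ) → 0ℚ < ε → ∃ λ (N : ℕ) → ∀ (n : ℕ) → n ≥ N →
    ∀ (G : Graph n) → MinDegAtLeast G α →
    ProbAtLeast n (p n) (Good G λ' (p n)) (1ℚ - ε))
theorem1p4 α 0<α α<1 = bias α , 0<λ , λ p (p∈[0,1] , pn²→∞ , pn→0) ε 0<ε →
  let 0<εα⁶ = 0<* 0<ε (0<* (0<* (0<* (0<* (0<* 0<α 0<α) 0<α) 0<α) 0<α) 0<α)
      -- `K` depends on `α` alone. `k₁` and `k₂` are lower bounds demanded of p n² and `k₃` one
      -- demanded of n; `scale` turns each into the hypothesis it serves.
      (K , 2≤Kα)    = archimedean α (1ℚ + 1ℚ) 0<α
      (k₁ , 2K≤)    = archimedean (bias α) (ℕ→ℚ K + ℕ→ℚ K) 0<λ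
      (k₂ , 2048≤)  = archimedean _ (ℕ→ℚ 2048) 0<εα⁶
      (k₃ , 2≤k₃α²) = archimedean (α * α) (1ℚ + 1ℚ) (0<* 0<α 0<α)
      (N₁ , h₁) = pn²→∞ k₁
      (N₂ , h₂) = pn²→∞ k₂
      (N₃ , h₃) = pn²→∞ 1
      (N₄ , h₄) = pn→0 (½ * (ε * bias α)) (0<* (ℚₚ.positive⁻¹ ½) (0<* 0<ε 0<λ))
      (N₅ , h₅) = pn→0 1ℚ (ℚₚ.positive⁻¹ 1ℚ)
      R = N₁ ℕ.⊔ (N₂ ℕ.⊔ (N₃ ℕ.⊔ (N₄ ℕ.⊔ N₅)))
  -- The successor excludes n = 0 and still yields n ≥ `k₃`.
  in suc k₃ ℕ.⊔ R , λ
    { zero n≥ G _ → ⊥-elim (ℕₚ.n≮0 (ℕₚ.m⊔n≤o⇒m≤o (suc k₃) R n≥))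
    ; (suc m) n≥ G minDeg →
      let n = suc m
          n≥₁ = ℕₚ.m⊔n≤o⇒n≤o (suc k₃) R n≥
          n≥₂ = ℕₚ.m⊔n≤o⇒n≤o N₁ _ n≥₁
          n≥₃ = ℕₚ.m⊔n≤o⇒n≤o N₂ _ n≥₂
          n≥₄ = ℕₚ.m⊔n≤o⇒n≤o N₃ _ n≥₃
      in good-whp G {K = ℕ→ℚ K} {ε = ε} 0<α (ℚₚ.<⇒≤ α<1) minDeg (proj₁ (p∈[0,1] n)) (proj₂ (p∈[0,1] n)) 2≤Kα
        (scale 0<λ 2K≤ (h₁ n (ℕₚ.m⊔n≤o⇒m≤o N₁ _ n≥₁)))
        (h₃ n (ℕₚ.m⊔n≤o⇒m≤o N₃ _ n≥₃))
        (scale 0<εα⁶ 2048≤ (h₂ n (ℕₚ.m⊔n≤o⇒m≤o N₂ _ n≥₂)))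
        (h₄ n (ℕₚ.m⊔n≤o⇒m≤o N₄ _ n≥₄))
        (h₅ n (ℕₚ.m⊔n≤o⇒n≤o N₄ _ n≥₄))
        (scale (0<* 0<α 0<α) 2≤k₃α² (ℕ→ℚ-mono (ℕₚ.≤-trans (ℕₚ.n≤1+n k₃) (ℕₚ.m⊔n≤o⇒m≤o (suc k₃) R n≥)))) }
  where
  0<λ : 0ℚ < bias α
  0<λ = 0<* (0<* 0<α 0<α) (ℚₚ.positive⁻¹ (ℤ.+ 1 / 24))
  scale : ∀ {a b k q} → 0ℚ < a → b ≤ k * a → k ≤ q → b ≤ a * q
  scale {a} {q = q} 0<a b≤ k≤q = ℚₚ.≤-trans b≤ (ℚₚ.≤-trans (*-monoʳ (ℚₚ.<⇒≤ 0<a) k≤q) (ℚₚ.≤-reflexive (ℚₚ.*-comm q a)))
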